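{- Let the polynomials $\psi_\nu$ be defined by the recurrence in the context; each $\psi_\nu$ has no constant term, and $\psi_1 = x_1$. Let $n \geq 2$ and let $p > n$ be an odd prime. Let $w_1,\ldots,w_n$ be rational numbers with denominators prime to $p$ such that $w_1 \equiv Q_p(1) \pmod{p}$ and, for $\ell = 2,\ldots,n$, \[ w_\ell \equiv Q_p(1) + p\,w_{\ell-1} + \sum_{\nu=1}^{\ell-1} p^\nu\Bigl(\widehat\sigma_{\nu+1}(Q_p) + \binom{p-1}{\nu+1}(-1)^\nu\, w_{\ell-\nu}^{\nu+1}\Bigr) \pmod{p^\ell}. \] Then for every $\ell = 1,\ldots,n$, \[ w_\ell \equiv \sum_{\nu=1}^{\ell}\frac{p^{\nu-1}}{\nu!}\,\psi_\nu\bigl(Q_p(1),\ldots,Q_p(\nu)\bigr) \pmod{p^\ell}. \]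
   Context: $q_p(a) = (a^{p-1}-1)/p$ is the Fermat quotient and $Q_p(m) = \sum_{a=1}^{p-1} q_p(a)^m$. Partial Bell polynomials: $B_{N,k}(y_1,\ldots,y_{N-k+1}) = \sum \frac{N!}{j_1!\cdots j_{N-k+1}!}\prod_{i}(y_i/i!)^{j_i}$ over nonnegative $j_i$ with $\sum_i i j_i = N$, $\sum_i j_i = k$; $B_N = \sum_{k=1}^N B_{N,k}$. Let $\sigma^\star_k = (-1)^k B_k(-x_1,-1!\,x_2,\ldots,-(k-1)!\,x_k)$ and $\widehat\sigma_k = \sigma^\star_k/k!$; $\widehat\sigma_k(Q_p)$ means $\widehat\sigma_k$ evaluated at $x_i = Q_p(i)$. Stirling numbers of the first kind $S_1(N,k)$ are defined by $x(x-1)\cdots(x-N+1) = \sum_k S_1(N,k)x^k$, and $(N)_k = N!/(N-k)!$. Define $\psi_0 = 0$ and for $N \geq 1$ \[ \psi_N = N\,\psi_{N-1} + \sigma^\star_N + \Psi_N,\qquad \Psi_N = \sum_{\nu=2}^{N}\sum_{k=0}^{\min(\nu,N-\nu)} (-1)^{\nu+1} S_1(\nu+1,k+1)\,(N)_k\, B_{N-k,\nu}(\psi_1,\ldots,\psi_{N-k-\nu+1}). \] -}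

module Defs where

open import Data.Bool using (Bool; true; false; if_then_else_; _∧_)
open import Data.Nat as ℕ using (ℕ; zero; suc; _∸_; _≡ᵇ_; _≤ᵇ_; _⊓_; NonZero)
open import Data.Nat.Properties using (_!≢0)
open import Data.Nat.Combinatorics using (_P_)
open import Data.Nat.Divisibility using (_∣_)
open import Data.Integer as ℤ using (ℤ; +_)
open import Data.Rational as Q using (ℚ; 0ℚ; 1ℚ)
open import Data.List using (List; []; _∷_; map; foldr; upTo; concatMap)
open import Data.Product using (∃; _×_)
open import Relation.Nullary using (¬_)
open import Relation.Binary.PropositionalEquality using (_≡_)

ℕ→ℚ : ℕ → ℚ
ℕ→ℚ n = + n Q./ 1

ℤ→ℚ : ℤ → ℚ
ℤ→ℚ z = z Q./ 1

powℚ : ℚ → ℕ → ℚ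
powℚ x zero    = 1ℚ
powℚ x (suc k) = x Q.* powℚ x k

sgn : ℕ → ℚ
sgn k = powℚ (Q.- 1ℚ) k

invFact : ℕ → ℚ
invFact k = (+ 1 Q./ (k ℕ.!)) {{k !≢0}}

sumℚ : List ℚ → ℚ
sumℚ = foldr Q._+_ 0ℚ

prodℚ : List ℚ → ℚ
prodℚ = foldr Q._*_ 1ℚ

fromTo : ℕ → ℕ → List ℕ
fromTo a b = map (a ℕ.+_) (upTo (suc b ∸ a))

Σ[_⋯_] : ℕ → ℕ → (ℕ → ℚ) → ℚ
Σ[ a ⋯ b ] f = sumℚ (map f (fromTo a b))

pIntegral : ℕ → ℚ → Set
pIntegral p c = ¬ (p ∣ ℚ.denominatorℕ c)

_≡_mod[_^_] : ℚ → ℚ → ℕ → ℕ → Set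
a ≡ b mod[ p ^ ℓ ] = ∃ λ c → pIntegral p c × (a Q.- b ≡ ℕ→ℚ (p ℕ.^ ℓ) Q.* c)

fermatQuotient : (p : ℕ) → .{{NonZero p}} → ℕ → ℚ
fermatQuotient p a = (+ (a ℕ.^ (p ∸ 1)) ℤ.- + 1) Q./ p

Qp : (p : ℕ) → .{{NonZero p}} → ℕ → ℚ
Qp p m = Σ[ 1 ⋯ p ∸ 1 ] (λ a → powℚ (fermatQuotient p a) m)

-- Partial Bell polynomials (explicit sum over (j_1,...,j_M), M = N-k+1)

tuples : ℕ → ℕ → List (List ℕ)
tuples zero    b = [] ∷ []
tuples (suc m) b = concatMap (λ j → map (j ∷_) (tuples m b)) (upTo (suc b))

wsum : ℕ → List ℕ → ℕ
wsum i []       = 0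
wsum i (j ∷ js) = i ℕ.* j ℕ.+ wsum (suc i) js

tsum : List ℕ → ℕ
tsum = foldr ℕ._+_ 0

invFactProd : List ℕ → ℚ
invFactProd js = prodℚ (map invFact js)

monomial : (ℕ → ℚ) → ℕ → List ℕ → ℚ
monomial y i []       = 1ℚ
monomial y i (j ∷ js) = powℚ (y i Q.* invFact i) j Q.* monomial y (suc i) js

bellTerm : ℕ → ℕ → (ℕ → ℚ) → List ℕ → ℚ
bellTerm N k y js =
  if (wsum 1 js ≡ᵇ N) ∧ (tsum js ≡ᵇ k)
  then ℕ→ℚ (N ℕ.!) Q.* invFactProd js Q.* monomial y 1 js
  else 0ℚ

bellPartial : ℕ → ℕ → (ℕ → ℚ) → ℚ
bellPartial N k y = sumℚ (map (bellTerm N k y) (tuples (N ∸ k ℕ.+ 1) N))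

bellComplete : ℕ → (ℕ → ℚ) → ℚ
bellComplete N y = Σ[ 1 ⋯ N ] (λ k → bellPartial N k y)

sigmaStar : (ℕ → ℚ) → ℕ → ℚ
sigmaStar x k = sgn k Q.* bellComplete k (λ i → Q.- (ℕ→ℚ ((i ∸ 1) ℕ.!) Q.* x i))

sigmaHat : (ℕ → ℚ) → ℕ → ℚ
sigmaHat x k = sigmaStar x k Q.* invFact k

-- Stirling numbers of the first kind, as coefficients of the falling
-- factorial x(x-1)⋯(x-N+1) (coefficient lists, constant term first)

scaleℤ : ℤ → List ℤ → List ℤ
scaleℤ c = map (c ℤ.*_)

addℤ : List ℤ → List ℤ → List ℤ
addℤ []       ys       = ys
addℤ xs       []       = xs
addℤ (x ∷ xs) (y ∷ ys) = (x ℤ.+ y) ∷ addℤ xs ys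

mulXminus : ℕ → List ℤ → List ℤ
mulXminus c cs = addℤ (+ 0 ∷ cs) (scaleℤ (ℤ.- (+ c)) cs)

fallingPoly : ℕ → List ℤ
fallingPoly zero    = + 1 ∷ []
fallingPoly (suc N) = mulXminus N (fallingPoly N)

coeff : List ℤ → ℕ → ℤ
coeff []       k       = + 0
coeff (c ∷ cs) zero    = c
coeff (c ∷ cs) (suc k) = coeff cs k

stirling1 : ℕ → ℕ → ℤ
stirling1 N k = coeff (fallingPoly N) k

-- Ψ_N, given the previously computed values prev i = ψ_i (i < N)
PsiTerm : ℕ → (ℕ → ℚ) → ℚ
PsiTerm N prev =
  Σ[ 2 ⋯ N ] (λ ν →
    Σ[ 0 ⋯ ν ⊓ (N ∸ ν) ] (λ k →
      sgn (ν ℕ.+ 1) Q.* ℤ→ℚ (stirling1 (ν ℕ.+ 1) (k ℕ.+ 1))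
        Q.* ℕ→ℚ (N P k) Q.* bellPartial (N ∸ k) ν prev))

psiStep : ℕ → (ℕ → ℚ) → (ℕ → ℚ) → ℚ
psiStep N x prev = ℕ→ℚ N Q.* prev (N ∸ 1) Q.+ sigmaStar x N Q.+ PsiTerm N prev

-- psiUpTo x N i = ψ_i(x) for i ≤ N
psiUpTo : (ℕ → ℚ) → ℕ → ℕ → ℚ
psiUpTo x zero    i = 0ℚ
psiUpTo x (suc N) i =
  if i ≤ᵇ N then psiUpTo x N i else psiStep (suc N) x (psiUpTo x N)

psi : (ℕ → ℚ) → ℕ → ℚ
psi x N = psiUpTo x N N

{-# OPTIONS --safe #-}
-- Put u_ν = ψ_ν/ν!. By the multinomial theorem B_{m,ν}(ψ)/m! is the coefficient of tᵐ in
-- (Σ u_i tⁱ)^ν/ν!, and Σ_k S₁(ν+1,k+1) pᵏ = (p-1)(p-2)⋯(p-ν) = ν! C(p-1,ν). Read as the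
-- coefficient of p^N, the recurrence of ψ therefore says that W = Σ p^(ν-1) u_ν solves
--   W ≡ Q_p(1) + p W + Σ p^ν (σ̂_{ν+1} + (-1)^ν C(p-1,ν+1) W^(ν+1)),
-- where everything is p-integral because factorials of numbers below p are prime to p and
-- Fermat quotients are integers. Modulo p^ℓ the right-hand side depends on its ν-th argument
-- only modulo p^(ℓ-ν), so strong induction on ℓ gives w_ℓ ≡ W modulo p^ℓ.
module Submission where

open import Defs
open import Data.Nat as ℕ using (ℕ; _≤_; _<_; _∸_; _+_; NonZero)
open import Data.Nat.Divisibility using (_∣_)
open import Data.Nat.Primality using (Prime)
open import Data.Nat.Combinatorics using (_C_)
open import Data.Rational as Q using (ℚ)
open import Relation.Nullary using (¬_)

open import Data.Bool using (Bool; true; false; if_then_else_; _∧_; T)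
open import Data.Bool.Properties using (∧-zeroʳ)
open import Data.Integer as ℤ using (ℤ; +_)
import Data.Integer.Properties as ℤₚ
open import Data.List using (List; []; _∷_; _++_; map; upTo; applyUpTo; concatMap)
open import Data.Nat using (zero; suc; _*_; z≤n; s≤s; _≡ᵇ_; _≤ᵇ_; _⊓_)
open import Data.Nat.Combinatorics using (_P_; nCk≡nPk/k!)
open import Data.Nat.Combinatorics.Base using (_P′_)
open import Data.Nat.Combinatorics.Specification using (k!∣nP′k; nP′k≡n!/[n∸k]!; nPk≡n!/[n∸k]!)
open import Data.Nat.Coprimality as Coprimality using (coprime-divisor)
open import Data.Nat.Divisibility using (divides; ∣⇒≤; ∣-trans; ∣1⇒≡1; m≤n⇒m!∣n!)
open import Data.Nat.DivMod using (m/n*n≡m; /-congˡ)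
open import Data.Nat.Primality using (euclidsLemma; prime⇒nonZero; prime⇒nonTrivial)
import Data.Nat.Properties as ℕₚ
open import Data.Nat.Properties using (_!≢0)
open import Data.Product using (_,_)
open import Data.Rational using (0ℚ; 1ℚ) renaming (_+_ to _⊕_; _*_ to _⊗_; _-_ to _⊖_; -_ to ⊝_)
import Data.Rational.Properties as ℚₚ
open import Data.Rational.Solver using (module +-*-Solver)
import Data.Rational.Unnormalised as U
import Data.Rational.Unnormalised.Properties as Uₚ
open import Data.Sum using (inj₁; inj₂; [_,_]′)
open import Function using (_∘_; id)
open import Relation.Nullary using (contradiction)
open import Relation.Binary.PropositionalEquality
open +-*-Solver using (solve; _:=_; _:+_; _:*_; _:-_; :-_; con)
open ≡-Reasoning

-- Rational arithmetic and finite sums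

-- For a fixed prime, "the coefficient of p^N" has no meaning by itself, the more so as C(p-1,ν)
-- depends on p too. The powers are therefore kept apart by a formal variable t: `G` and `H` are
-- coefficient sequences in t, with the Stirling polynomial also read in t, and only `ev` puts t =
-- p. That evaluation is truncated, and the dropped degrees are multiples of a power of p only when
-- their coefficients are p-integral. Integrality of ψ_ν/ν! thus has to precede every congruence
-- about W; it comes out of the recurrence itself, where n < p makes all factorials in sight prime
-- to p. Since ψ_0 = 0, the series Σ u_m tᵐ starts in degree 1, and its value is p W rather than W.
-- The congruence is first obtained for p W with one extra power of p and then divided by p; this is
-- how (p W)^(ν+1) becomes p^ν W^(ν+1).

ℤ→ℚ-toℚᵘ : ∀ z → Q.toℚᵘ (ℤ→ℚ z) U.≃ U.mkℚᵘ z 0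
ℤ→ℚ-toℚᵘ z = ℚₚ.toℚᵘ-fromℚᵘ (U.mkℚᵘ z 0)

-- `Q./` normalises by a gcd, so the homomorphism laws are checked on unnormalised fractions, where
-- both sides are explicit.
ℤ→ℚ-+ : ∀ a b → ℤ→ℚ (a ℤ.+ b) ≡ ℤ→ℚ a ⊕ ℤ→ℚ b
ℤ→ℚ-+ a b = ℚₚ.toℚᵘ-injective (Uₚ.≃-trans (ℤ→ℚ-toℚᵘ (a ℤ.+ b))
  (Uₚ.≃-trans (U.*≡* (cong (ℤ._* + 1) (sym (cong₂ ℤ._+_ (ℤₚ.*-identityʳ a) (ℤₚ.*-identityʳ b)))))
  (Uₚ.≃-sym (Uₚ.≃-trans (ℚₚ.toℚᵘ-homo-+ (ℤ→ℚ a) (ℤ→ℚ b)) (Uₚ.+-cong (ℤ→ℚ-toℚᵘ a) (ℤ→ℚ-toℚᵘ b))))))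

ℤ→ℚ-* : ∀ a b → ℤ→ℚ (a ℤ.* b) ≡ ℤ→ℚ a ⊗ ℤ→ℚ b
ℤ→ℚ-* a b = ℚₚ.toℚᵘ-injective (Uₚ.≃-trans (ℤ→ℚ-toℚᵘ (a ℤ.* b))
  (Uₚ.≃-sym (Uₚ.≃-trans (ℚₚ.toℚᵘ-homo-* (ℤ→ℚ a) (ℤ→ℚ b)) (Uₚ.*-cong (ℤ→ℚ-toℚᵘ a) (ℤ→ℚ-toℚᵘ b)))))

ℤ→ℚ-neg : ∀ a → ℤ→ℚ (ℤ.- a) ≡ ⊝ ℤ→ℚ a
ℤ→ℚ-neg a = ℚₚ.toℚᵘ-injective (Uₚ.≃-trans (ℤ→ℚ-toℚᵘ (ℤ.- a))
  (Uₚ.≃-sym (Uₚ.≃-trans (ℚₚ.toℚᵘ-homo‿- (ℤ→ℚ a)) (Uₚ.-‿cong (ℤ→ℚ-toℚᵘ a)))))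

ℤ→ℚ-injective : ∀ {a b} → ℤ→ℚ a ≡ ℤ→ℚ b → a ≡ b
ℤ→ℚ-injective {a} {b} e with Uₚ.≃-trans (Uₚ.≃-sym (ℤ→ℚ-toℚᵘ a)) (Uₚ.≃-trans (Uₚ.≃-reflexive (cong Q.toℚᵘ e)) (ℤ→ℚ-toℚᵘ b))
... | U.*≡* q = trans (sym (ℤₚ.*-identityʳ a)) (trans q (ℤₚ.*-identityʳ b))

/-*-cancel : ∀ z n .{{_ : NonZero n}} → (z Q./ n) ⊗ ℕ→ℚ n ≡ ℤ→ℚ z
/-*-cancel z n@(suc k) = ℚₚ.toℚᵘ-injective
  (Uₚ.≃-trans (ℚₚ.toℚᵘ-homo-* (z Q./ n) (ℕ→ℚ n))
  (Uₚ.≃-trans (Uₚ.*-cong (ℚₚ.toℚᵘ-fromℚᵘ (U.mkℚᵘ z k)) (ℤ→ℚ-toℚᵘ (+ n)))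
  (Uₚ.≃-trans (U.*≡* (trans (ℤₚ.*-identityʳ _) (cong (z ℤ.*_) (sym (ℤₚ.*-identityʳ (+ n))))))
  (Uₚ.≃-sym (ℤ→ℚ-toℚᵘ z)))))

ℕ→ℚ-+ : ∀ a b → ℕ→ℚ (a + b) ≡ ℕ→ℚ a ⊕ ℕ→ℚ b
ℕ→ℚ-+ a b = ℤ→ℚ-+ (+ a) (+ b)

ℕ→ℚ-* : ∀ a b → ℕ→ℚ (a * b) ≡ ℕ→ℚ a ⊗ ℕ→ℚ b
ℕ→ℚ-* a b = trans (cong ℤ→ℚ (ℤₚ.pos-* a b)) (ℤ→ℚ-* (+ a) (+ b))

ℕ→ℚ-^ : ∀ a k → ℕ→ℚ (a ℕ.^ k) ≡ powℚ (ℕ→ℚ a) k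
ℕ→ℚ-^ a zero    = refl
ℕ→ℚ-^ a (suc k) = trans (ℕ→ℚ-* a (a ℕ.^ k)) (cong (ℕ→ℚ a ⊗_) (ℕ→ℚ-^ a k))

ℕ→ℚ-cancelˡ : ∀ n .{{_ : NonZero n}} {a b} → ℕ→ℚ n ⊗ a ≡ ℕ→ℚ n ⊗ b → a ≡ b
ℕ→ℚ-cancelˡ n {a} {b} e = begin
  a               ≡⟨ undo a ⟨
  r ⊗ (ℕ→ℚ n ⊗ a) ≡⟨ cong (r ⊗_) e ⟩
  r ⊗ (ℕ→ℚ n ⊗ b) ≡⟨ undo b ⟩
  b               ∎
  where
  r : ℚ
  r = + 1 Q./ n
  undo : ∀ c → r ⊗ (ℕ→ℚ n ⊗ c) ≡ c
  undo c = trans (sym (ℚₚ.*-assoc r (ℕ→ℚ n) c)) (trans (cong (_⊗ c) (/-*-cancel (+ 1) n)) (ℚₚ.*-identityˡ c))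

invFact-! : ∀ k → invFact k ⊗ ℕ→ℚ (k ℕ.!) ≡ 1ℚ
invFact-! k = /-*-cancel (+ 1) (k ℕ.!) {{k !≢0}}

!-invFact : ∀ k → ℕ→ℚ (k ℕ.!) ⊗ invFact k ≡ 1ℚ
!-invFact k = trans (ℚₚ.*-comm (ℕ→ℚ (k ℕ.!)) (invFact k)) (invFact-! k)

suc-invFact : ∀ k → ℕ→ℚ (suc k) ⊗ invFact (suc k) ≡ invFact k
suc-invFact k = ℕ→ℚ-cancelˡ (k ℕ.!) {{k !≢0}} (begin
  K ⊗ (S ⊗ invFact (suc k))  ≡⟨ solve 3 (λ a b c → a :* (b :* c) := (b :* a) :* c) refl K S (invFact (suc k)) ⟩
  S ⊗ K ⊗ invFact (suc k)    ≡⟨ cong (_⊗ invFact (suc k)) (ℕ→ℚ-* (suc k) (k ℕ.!)) ⟨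
  ℕ→ℚ (suc k ℕ.!) ⊗ invFact (suc k) ≡⟨ !-invFact (suc k) ⟩
  1ℚ                         ≡⟨ !-invFact k ⟨
  K ⊗ invFact k              ∎)
  where
  K = ℕ→ℚ (k ℕ.!)
  S = ℕ→ℚ (suc k)

powℚ-+ : ∀ x a b → powℚ x (a + b) ≡ powℚ x a ⊗ powℚ x b
powℚ-+ x zero    b = sym (ℚₚ.*-identityˡ _)
powℚ-+ x (suc a) b = trans (cong (x ⊗_) (powℚ-+ x a b)) (sym (ℚₚ.*-assoc x (powℚ x a) (powℚ x b)))

powℚ-distrib-* : ∀ x y k → powℚ (x ⊗ y) k ≡ powℚ x k ⊗ powℚ y k
powℚ-distrib-* x y zero    = refl
powℚ-distrib-* x y (suc k) = trans (cong (x ⊗ y ⊗_) (powℚ-distrib-* x y k))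
  (solve 4 (λ a b c d → a :* b :* (c :* d) := a :* c :* (b :* d)) refl x y (powℚ x k) (powℚ y k))

powℚ-powℚ : ∀ x i j → powℚ (powℚ x i) j ≡ powℚ x (i * j)
powℚ-powℚ x i zero    = cong (powℚ x) (sym (ℕₚ.*-zeroʳ i))
powℚ-powℚ x i (suc j) = begin
  powℚ x i ⊗ powℚ (powℚ x i) j ≡⟨ cong (powℚ x i ⊗_) (powℚ-powℚ x i j) ⟩
  powℚ x i ⊗ powℚ x (i * j)    ≡⟨ powℚ-+ x i (i * j) ⟨
  powℚ x (i + i * j)           ≡⟨ cong (powℚ x) (ℕₚ.*-suc i j) ⟨
  powℚ x (i * suc j)           ∎

∑ : ℕ → (ℕ → ℚ) → ℚ
∑ zero    f = 0ℚ
∑ (suc n) f = f 0 ⊕ ∑ n (f ∘ suc)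

sumℚ-map-applyUpTo : ∀ (f : ℕ → ℚ) g n → sumℚ (map f (applyUpTo g n)) ≡ ∑ n (f ∘ g)
sumℚ-map-applyUpTo f g zero    = refl
sumℚ-map-applyUpTo f g (suc n) = cong (f (g 0) ⊕_) (sumℚ-map-applyUpTo f (g ∘ suc) n)

Σ[⋯]-∑ : ∀ a b f → Σ[ a ⋯ b ] f ≡ ∑ (suc b ∸ a) (f ∘ (a ℕ.+_))
Σ[⋯]-∑ a b f = trans (cong sumℚ (sym (map-∘′ (upTo (suc b ∸ a))))) (sumℚ-map-applyUpTo (f ∘ (a ℕ.+_)) id (suc b ∸ a))
  where
  map-∘′ : ∀ xs → map (f ∘ (a ℕ.+_)) xs ≡ map f (map (a ℕ.+_) xs)
  map-∘′ []       = refl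
  map-∘′ (x ∷ xs) = cong (f (a + x) ∷_) (map-∘′ xs)

∑-cong : ∀ n {f g : ℕ → ℚ} → (∀ i → i < n → f i ≡ g i) → ∑ n f ≡ ∑ n g
∑-cong zero    e = refl
∑-cong (suc n) e = cong₂ _⊕_ (e 0 (s≤s z≤n)) (∑-cong n (λ i i<n → e (suc i) (s≤s i<n)))

∑-zero : ∀ n {f : ℕ → ℚ} → (∀ i → i < n → f i ≡ 0ℚ) → ∑ n f ≡ 0ℚ
∑-zero zero    e = refl
∑-zero (suc n) e = cong₂ _⊕_ (e 0 (s≤s z≤n)) (∑-zero n (λ i i<n → e (suc i) (s≤s i<n)))

∑-+ : ∀ n (f g : ℕ → ℚ) → ∑ n (λ i → f i ⊕ g i) ≡ ∑ n f ⊕ ∑ n g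
∑-+ zero    f g = refl
∑-+ (suc n) f g = trans (cong (f 0 ⊕ g 0 ⊕_) (∑-+ n (f ∘ suc) (g ∘ suc)))
  (solve 4 (λ a b c d → a :+ b :+ (c :+ d) := a :+ c :+ (b :+ d)) refl (f 0) (g 0) (∑ n (f ∘ suc)) (∑ n (g ∘ suc)))

∑-*ˡ : ∀ n c (f : ℕ → ℚ) → ∑ n (λ i → c ⊗ f i) ≡ c ⊗ ∑ n f
∑-*ˡ zero    c f = sym (ℚₚ.*-zeroʳ c)
∑-*ˡ (suc n) c f = trans (cong (c ⊗ f 0 ⊕_) (∑-*ˡ n c (f ∘ suc))) (sym (ℚₚ.*-distribˡ-+ c (f 0) (∑ n (f ∘ suc))))

∑-*ʳ : ∀ n c (f : ℕ → ℚ) → ∑ n (λ i → f i ⊗ c) ≡ ∑ n f ⊗ c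
∑-*ʳ n c f = trans (∑-cong n (λ i _ → ℚₚ.*-comm (f i) c)) (trans (∑-*ˡ n c f) (ℚₚ.*-comm c (∑ n f)))

∑-last : ∀ n (f : ℕ → ℚ) → ∑ (suc n) f ≡ ∑ n f ⊕ f n
∑-last zero    f = ℚₚ.+-comm (f 0) 0ℚ
∑-last (suc n) f = trans (cong (f 0 ⊕_) (∑-last n (f ∘ suc))) (sym (ℚₚ.+-assoc (f 0) (∑ n (f ∘ suc)) (f (suc n))))

∑-swap : ∀ m n (f : ℕ → ℕ → ℚ) → ∑ m (λ i → ∑ n (f i)) ≡ ∑ n (λ j → ∑ m (λ i → f i j))
∑-swap zero    n f = sym (∑-zero n (λ _ _ → refl))
∑-swap (suc m) n f = trans (cong (∑ n (f 0) ⊕_) (∑-swap m n (f ∘ suc))) (sym (∑-+ n (f 0) (λ j → ∑ m (λ i → f (suc i) j))))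

∑-truncate : ∀ {n m} (f : ℕ → ℚ) → n ≤ m → (∀ i → n ≤ i → i < m → f i ≡ 0ℚ) → ∑ m f ≡ ∑ n f
∑-truncate f z≤n     e = ∑-zero _ (λ i → e i z≤n)
∑-truncate f (s≤s l) e = cong (f 0 ⊕_) (∑-truncate (f ∘ suc) l (λ i n≤i i<m → e (suc i) (s≤s n≤i) (s≤s i<m)))

-- The divided power a^j/j!. Its binomial theorem has no coefficients, and it absorbs the 1/j! of
-- the Bell polynomials.
divPow : ℚ → ℕ → ℚ
divPow a j = powℚ a j ⊗ invFact j

divPow-suc : ∀ a j → ℕ→ℚ (suc j) ⊗ divPow a (suc j) ≡ a ⊗ divPow a j
divPow-suc a j = begin
  ℕ→ℚ (suc j) ⊗ (a ⊗ powℚ a j ⊗ invFact (suc j))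
    ≡⟨ solve 4 (λ s a q i → s :* (a :* q :* i) := a :* (q :* (s :* i))) refl (ℕ→ℚ (suc j)) a (powℚ a j) (invFact (suc j)) ⟩
  a ⊗ (powℚ a j ⊗ (ℕ→ℚ (suc j) ⊗ invFact (suc j)))
    ≡⟨ cong (λ z → a ⊗ (powℚ a j ⊗ z)) (suc-invFact j) ⟩
  a ⊗ divPow a j ∎

divPow-* : ∀ c a j → divPow (c ⊗ a) j ≡ powℚ c j ⊗ divPow a j
divPow-* c a j = trans (cong (_⊗ invFact j) (powℚ-distrib-* c a j)) (ℚₚ.*-assoc (powℚ c j) (powℚ a j) (invFact j))

divPow-! : ∀ a j → ℕ→ℚ (j ℕ.!) ⊗ divPow a j ≡ powℚ a j
divPow-! a j = trans (solve 3 (λ n q i → n :* (q :* i) := q :* (i :* n)) refl (ℕ→ℚ (j ℕ.!)) (powℚ a j) (invFact j))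
  (trans (cong (powℚ a j ⊗_) (invFact-! j)) (ℚₚ.*-identityʳ (powℚ a j)))

-- The Leibniz-type weight j + (ν + 1 - j) splits (ν + 1) times the convolution.
divPow-+ : ∀ a b ν → divPow (a ⊕ b) ν ≡ ∑ (suc ν) (λ j → divPow a j ⊗ divPow b (ν ∸ j))
divPow-+ a b zero    = refl
divPow-+ a b (suc ν) = ℕ→ℚ-cancelˡ (suc ν) (begin
  S ⊗ divPow (a ⊕ b) (suc ν)           ≡⟨ divPow-suc (a ⊕ b) ν ⟩
  (a ⊕ b) ⊗ divPow (a ⊕ b) ν           ≡⟨ cong ((a ⊕ b) ⊗_) (divPow-+ a b ν) ⟩
  (a ⊕ b) ⊗ ∑ (suc ν) conv         ≡⟨ ℚₚ.*-distribʳ-+ (∑ (suc ν) conv) a b ⟩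
  a ⊗ ∑ (suc ν) conv ⊕ b ⊗ ∑ (suc ν) conv ≡⟨ cong₂ _⊕_ (sym left) (sym right) ⟩
  ∑ (suc (suc ν)) (λ j → ℕ→ℚ j ⊗ t j) ⊕ ∑ (suc (suc ν)) (λ j → ℕ→ℚ (suc ν ∸ j) ⊗ t j)
    ≡⟨ ∑-+ (suc (suc ν)) (λ j → ℕ→ℚ j ⊗ t j) (λ j → ℕ→ℚ (suc ν ∸ j) ⊗ t j) ⟨
  ∑ (suc (suc ν)) (λ j → ℕ→ℚ j ⊗ t j ⊕ ℕ→ℚ (suc ν ∸ j) ⊗ t j)
    ≡⟨ ∑-cong (suc (suc ν)) weight ⟩
  ∑ (suc (suc ν)) (λ j → S ⊗ t j)  ≡⟨ ∑-*ˡ (suc (suc ν)) S t ⟩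
  S ⊗ ∑ (suc (suc ν)) t            ∎)
  where
  S = ℕ→ℚ (suc ν)
  conv t : ℕ → ℚ
  conv j = divPow a j ⊗ divPow b (ν ∸ j)
  t j = divPow a j ⊗ divPow b (suc ν ∸ j)
  weight : ∀ j → j < suc (suc ν) → ℕ→ℚ j ⊗ t j ⊕ ℕ→ℚ (suc ν ∸ j) ⊗ t j ≡ S ⊗ t j
  weight j (s≤s j≤) = trans (sym (ℚₚ.*-distribʳ-+ (t j) (ℕ→ℚ j) (ℕ→ℚ (suc ν ∸ j))))
    (cong (_⊗ t j) (trans (sym (ℕ→ℚ-+ j (suc ν ∸ j))) (cong ℕ→ℚ (ℕₚ.m+[n∸m]≡n j≤))))
  left : ∑ (suc (suc ν)) (λ j → ℕ→ℚ j ⊗ t j) ≡ a ⊗ ∑ (suc ν) conv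
  left = begin
    ℕ→ℚ 0 ⊗ t 0 ⊕ ∑ (suc ν) (λ j → ℕ→ℚ (suc j) ⊗ t (suc j))
      ≡⟨ cong₂ _⊕_ (ℚₚ.*-zeroˡ (t 0)) (∑-cong (suc ν) (λ j _ → trans (sym (ℚₚ.*-assoc (ℕ→ℚ (suc j)) (divPow a (suc j)) (divPow b (ν ∸ j))))
           (trans (cong (_⊗ divPow b (ν ∸ j)) (divPow-suc a j)) (ℚₚ.*-assoc a (divPow a j) (divPow b (ν ∸ j)))))) ⟩
    0ℚ ⊕ ∑ (suc ν) (λ j → a ⊗ conv j) ≡⟨ ℚₚ.+-identityˡ _ ⟩
    ∑ (suc ν) (λ j → a ⊗ conv j)      ≡⟨ ∑-*ˡ (suc ν) a conv ⟩
    a ⊗ ∑ (suc ν) conv ∎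
  right : ∑ (suc (suc ν)) (λ j → ℕ→ℚ (suc ν ∸ j) ⊗ t j) ≡ b ⊗ ∑ (suc ν) conv
  right = begin
    ∑ (suc (suc ν)) (λ j → ℕ→ℚ (suc ν ∸ j) ⊗ t j) ≡⟨ ∑-last (suc ν) (λ j → ℕ→ℚ (suc ν ∸ j) ⊗ t j) ⟩
    ∑ (suc ν) (λ j → ℕ→ℚ (suc ν ∸ j) ⊗ t j) ⊕ ℕ→ℚ (suc ν ∸ suc ν) ⊗ t (suc ν)
      ≡⟨ cong₂ _⊕_ (∑-cong (suc ν) term) (trans (cong (λ z → ℕ→ℚ z ⊗ t (suc ν)) (ℕₚ.n∸n≡0 ν)) (ℚₚ.*-zeroˡ (t (suc ν)))) ⟩
    ∑ (suc ν) (λ j → b ⊗ conv j) ⊕ 0ℚ ≡⟨ ℚₚ.+-identityʳ _ ⟩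
    ∑ (suc ν) (λ j → b ⊗ conv j)      ≡⟨ ∑-*ˡ (suc ν) b conv ⟩
    b ⊗ ∑ (suc ν) conv ∎
    where
    term : ∀ j → j < suc ν → ℕ→ℚ (suc ν ∸ j) ⊗ t j ≡ b ⊗ conv j
    term j (s≤s j≤ν) rewrite ℕₚ.+-∸-assoc 1 j≤ν = begin
      ℕ→ℚ (suc (ν ∸ j)) ⊗ (divPow a j ⊗ divPow b (suc (ν ∸ j)))
        ≡⟨ solve 3 (λ s x y → s :* (x :* y) := x :* (s :* y)) refl (ℕ→ℚ (suc (ν ∸ j))) (divPow a j) (divPow b (suc (ν ∸ j))) ⟩
      divPow a j ⊗ (ℕ→ℚ (suc (ν ∸ j)) ⊗ divPow b (suc (ν ∸ j))) ≡⟨ cong (divPow a j ⊗_) (divPow-suc b (ν ∸ j)) ⟩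
      divPow a j ⊗ (b ⊗ divPow b (ν ∸ j)) ≡⟨ solve 3 (λ s x y → s :* (x :* y) := x :* (s :* y)) refl (divPow a j) b (divPow b (ν ∸ j)) ⟩
      b ⊗ conv j ∎

-- Partial Bell polynomials as coefficients of divided powers

-- Multiplication of the power series Σ f(m) tᵐ by tˢ.
shift : ℕ → (ℕ → ℚ) → ℕ → ℚ
shift zero    f m       = f m
shift (suc s) f zero    = 0ℚ
shift (suc s) f (suc m) = shift s f m

-- Only the value at m - s matters. The equation `m ≡ s + m′` is handed to the caller because the
-- degree bounds below are derived from it.
shift-cong : ∀ s {f g : ℕ → ℚ} m → (∀ m′ → m ≡ s + m′ → f m′ ≡ g m′) → shift s f m ≡ shift s g m
shift-cong zero    m       e = e m refl
shift-cong (suc s) zero    e = refl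
shift-cong (suc s) (suc m) e = shift-cong s m (λ m′ q → e m′ (cong suc q))

shift-zero : ∀ s {f : ℕ → ℚ} m → (∀ m′ → m ≡ s + m′ → f m′ ≡ 0ℚ) → shift s f m ≡ 0ℚ
shift-zero zero    m       e = e m refl
shift-zero (suc s) zero    e = refl
shift-zero (suc s) (suc m) e = shift-zero s m (λ m′ q → e m′ (cong suc q))

shift-≤ : ∀ s (f : ℕ → ℚ) m → s ≤ m → shift s f m ≡ f (m ∸ s)
shift-≤ zero    f m       _         = refl
shift-≤ (suc s) f (suc m) (s≤s s≤m) = shift-≤ s f m s≤m

-- The coefficient of tᵐ in (Σ u_l tˡ)^ν / ν!, where l runs over i, …, i + M - 1.
G : (ℕ → ℚ) → ℕ → ℕ → ℕ → ℕ → ℚ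
G u i zero    zero    zero    = 1ℚ
G u i zero    zero    (suc m) = 0ℚ
G u i zero    (suc ν) m       = 0ℚ
G u i (suc M) ν       m       = ∑ (suc ν) (λ j → divPow (u i) j ⊗ shift (i * j) (G u (suc i) M (ν ∸ j)) m)

-- Sums over lists and over exponent tuples

module _ {A : Set} where

  sumOver : List A → (A → ℚ) → ℚ
  sumOver xs f = sumℚ (map f xs)

  sumOver-cong : ∀ xs {f g : A → ℚ} → (∀ x → f x ≡ g x) → sumOver xs f ≡ sumOver xs g
  sumOver-cong []       e = refl
  sumOver-cong (x ∷ xs) e = cong₂ _⊕_ (e x) (sumOver-cong xs e)

  sumOver-zero : ∀ xs → sumOver xs (λ _ → 0ℚ) ≡ 0ℚ
  sumOver-zero []       = refl
  sumOver-zero (x ∷ xs) = trans (ℚₚ.+-identityˡ _) (sumOver-zero xs)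

  sumOver-*ˡ : ∀ xs c (f : A → ℚ) → sumOver xs (λ x → c ⊗ f x) ≡ c ⊗ sumOver xs f
  sumOver-*ˡ []       c f = sym (ℚₚ.*-zeroʳ c)
  sumOver-*ˡ (x ∷ xs) c f = trans (cong (c ⊗ f x ⊕_) (sumOver-*ˡ xs c f)) (sym (ℚₚ.*-distribˡ-+ c (f x) (sumOver xs f)))

  sumOver-++ : ∀ xs ys (f : A → ℚ) → sumOver (xs ++ ys) f ≡ sumOver xs f ⊕ sumOver ys f
  sumOver-++ []       ys f = sym (ℚₚ.+-identityˡ _)
  sumOver-++ (x ∷ xs) ys f = trans (cong (f x ⊕_) (sumOver-++ xs ys f)) (sym (ℚₚ.+-assoc (f x) (sumOver xs f) (sumOver ys f)))

  sumOver-map : ∀ {B : Set} (h : B → A) xs (f : A → ℚ) → sumOver (map h xs) f ≡ sumℚ (map (f ∘ h) xs)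
  sumOver-map h []       f = refl
  sumOver-map h (x ∷ xs) f = cong (f (h x) ⊕_) (sumOver-map h xs f)

  sumOver-concatMap : ∀ (h : ℕ → List A) g n (f : A → ℚ) →
    sumOver (concatMap h (applyUpTo g n)) f ≡ ∑ n (λ j → sumOver (h (g j)) f)
  sumOver-concatMap h g zero    f = refl
  sumOver-concatMap h g (suc n) f = trans (sumOver-++ (h (g 0)) (concatMap h (applyUpTo (g ∘ suc) n)) f)
    (cong (sumOver (h (g 0)) f ⊕_) (sumOver-concatMap h (g ∘ suc) n f))

sumOver-tuples : ∀ M b (f : List ℕ → ℚ) →
  sumOver (tuples (suc M) b) f ≡ ∑ (suc b) (λ j → sumOver (tuples M b) (λ js → f (j ∷ js)))
sumOver-tuples M b f = trans (sumOver-concatMap (λ j → map (j ∷_) (tuples M b)) id (suc b) f)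
  (∑-cong (suc b) (λ j _ → sumOver-map (j ∷_) (tuples M b) f))

≡ᵇ-cancel-≤ : ∀ j t ν → j ≤ ν → (j + t ≡ᵇ ν) ≡ (t ≡ᵇ ν ∸ j)
≡ᵇ-cancel-≤ zero    t ν       _       = refl
≡ᵇ-cancel-≤ (suc j) t (suc ν) (s≤s l) = ≡ᵇ-cancel-≤ j t ν l

≡ᵇ-> : ∀ j t ν → ν < j → (j + t ≡ᵇ ν) ≡ false
≡ᵇ-> (suc j) t zero    _       = refl
≡ᵇ-> (suc j) t (suc ν) (s≤s l) = ≡ᵇ-> j t ν l

-- The boolean test strips one successor from both sides at a time, exactly as `shift` does; if m
-- runs out first, every test fails and the sum is 0.
sumOver-shift : ∀ {A : Set} (xs : List A) s (w : A → ℕ) (b : A → Bool) (f : A → ℚ) m →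
  sumOver xs (λ x → if (s + w x ≡ᵇ m) ∧ b x then f x else 0ℚ)
    ≡ shift s (λ m′ → sumOver xs (λ x → if (w x ≡ᵇ m′) ∧ b x then f x else 0ℚ)) m
sumOver-shift xs zero    w b f m       = refl
sumOver-shift xs (suc s) w b f zero    = sumOver-zero xs
sumOver-shift xs (suc s) w b f (suc m) = sumOver-shift xs s w b f m

shift-*ˡ : ∀ s c f m → shift s (λ m′ → c ⊗ f m′) m ≡ c ⊗ shift s f m
shift-*ˡ zero    c f m       = refl
shift-*ˡ (suc s) c f zero    = sym (ℚₚ.*-zeroʳ c)
shift-*ˡ (suc s) c f (suc m) = shift-*ˡ s c f m

scaled : (ℕ → ℚ) → ℕ → ℚ
scaled y i = y i ⊗ invFact i

-- Induction on the tuple length, splitting off the first entry j: its factor is a divided power,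
-- its weight i * j a shift, and j of the ν parts are used up. The bound b on the entries stays
-- fixed while ν decreases, hence ν ≤ b instead of an equality; entries above ν already violate the
-- condition on the sum.
bellSum-G : ∀ y i M b ν m → ν ≤ b →
  sumOver (tuples M b) (λ js → if (wsum i js ≡ᵇ m) ∧ (tsum js ≡ᵇ ν) then invFactProd js ⊗ monomial y i js else 0ℚ)
    ≡ G (scaled y) i M ν m
bellSum-G y i zero    b zero    zero    _ = refl
bellSum-G y i zero    b zero    (suc m) _ = refl
bellSum-G y i zero    b (suc ν) zero    _ = refl
bellSum-G y i zero    b (suc ν) (suc m) _ = refl
bellSum-G y i (suc M) b ν       m     ν≤b = begin
  sumOver (tuples (suc M) b) (term i m ν)
    ≡⟨ sumOver-tuples M b (term i m ν) ⟩
  ∑ (suc b) (λ j → sumOver (tuples M b) (λ js → term i m ν (j ∷ js)))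
    ≡⟨ ∑-truncate _ (s≤s ν≤b) large ⟩
  ∑ (suc ν) (λ j → sumOver (tuples M b) (λ js → term i m ν (j ∷ js)))
    ≡⟨ ∑-cong (suc ν) small ⟩
  G (scaled y) i (suc M) ν m ∎
  where
  term : ℕ → ℕ → ℕ → List ℕ → ℚ
  term i m ν js = if (wsum i js ≡ᵇ m) ∧ (tsum js ≡ᵇ ν) then invFactProd js ⊗ monomial y i js else 0ℚ
  large : ∀ j → suc ν ≤ j → j < suc b → sumOver (tuples M b) (λ js → term i m ν (j ∷ js)) ≡ 0ℚ
  large j ν<j _ = trans (sumOver-cong (tuples M b) vanish) (sumOver-zero (tuples M b))
    where
    vanish : ∀ js → term i m ν (j ∷ js) ≡ 0ℚ
    vanish js rewrite ≡ᵇ-> j (tsum js) ν ν<j | ∧-zeroʳ (i * j + wsum (suc i) js ≡ᵇ m) = refl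
  small : ∀ j → j < suc ν → sumOver (tuples M b) (λ js → term i m ν (j ∷ js))
    ≡ divPow (scaled y i) j ⊗ shift (i * j) (G (scaled y) (suc i) M (ν ∸ j)) m
  small j (s≤s j≤ν) = begin
    sumOver (tuples M b) (λ js → term i m ν (j ∷ js)) ≡⟨ sumOver-cong (tuples M b) pull ⟩
    sumOver (tuples M b) (λ js → d ⊗ shifted js) ≡⟨ sumOver-*ˡ (tuples M b) d shifted ⟩
    d ⊗ sumOver (tuples M b) shifted
      ≡⟨ cong (d ⊗_) (sumOver-shift (tuples M b) (i * j) (wsum (suc i)) (λ js → tsum js ≡ᵇ ν ∸ j) (λ js → invFactProd js ⊗ monomial y (suc i) js) m) ⟩
    d ⊗ shift (i * j) (λ m′ → sumOver (tuples M b) (term (suc i) m′ (ν ∸ j))) m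
      ≡⟨ cong (d ⊗_) (shift-cong (i * j) m (λ m′ _ → bellSum-G y (suc i) M b (ν ∸ j) m′ (ℕₚ.≤-trans (ℕₚ.m∸n≤m ν j) ν≤b))) ⟩
    d ⊗ shift (i * j) (G (scaled y) (suc i) M (ν ∸ j)) m ∎
    where
    d = divPow (scaled y i) j
    shifted : List ℕ → ℚ
    shifted js = if (i * j + wsum (suc i) js ≡ᵇ m) ∧ (tsum js ≡ᵇ ν ∸ j) then invFactProd js ⊗ monomial y (suc i) js else 0ℚ
    pull : ∀ js → term i m ν (j ∷ js) ≡ d ⊗ shifted js
    pull js rewrite ≡ᵇ-cancel-≤ j (tsum js) ν j≤ν with (i * j + wsum (suc i) js ≡ᵇ m) ∧ (tsum js ≡ᵇ ν ∸ j)
    ... | true  = solve 4 (λ a b c d → a :* b :* (c :* d) := c :* a :* (b :* d)) refl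
                    (invFact j) (invFactProd js) (powℚ (scaled y i) j) (monomial y (suc i) js)
    ... | false = sym (ℚₚ.*-zeroʳ d)

bellPartial-G : ∀ N k y → k ≤ N → bellPartial N k y ≡ ℕ→ℚ (N ℕ.!) ⊗ G (scaled y) 1 (N ∸ k + 1) k N
bellPartial-G N k y k≤N = begin
  sumOver ts (bellTerm N k y)   ≡⟨ sumOver-cong ts pull ⟩
  sumOver ts (λ js → n! ⊗ term js) ≡⟨ sumOver-*ˡ ts n! term ⟩
  n! ⊗ sumOver ts term          ≡⟨ cong (n! ⊗_) (bellSum-G y 1 (N ∸ k + 1) N k N k≤N) ⟩
  n! ⊗ G (scaled y) 1 (N ∸ k + 1) k N ∎
  where
  ts = tuples (N ∸ k + 1) N
  n! = ℕ→ℚ (N ℕ.!)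
  term : List ℕ → ℚ
  term js = if (wsum 1 js ≡ᵇ N) ∧ (tsum js ≡ᵇ k) then invFactProd js ⊗ monomial y 1 js else 0ℚ
  pull : ∀ js → bellTerm N k y js ≡ n! ⊗ term js
  pull js with (wsum 1 js ≡ᵇ N) ∧ (tsum js ≡ᵇ k)
  ... | true  = ℚₚ.*-assoc n! (invFactProd js) (monomial y 1 js)
  ... | false = sym (ℚₚ.*-zeroʳ n!)

G-cong : ∀ {u u′ : ℕ → ℚ} i M → (∀ l → i ≤ l → l < i + M → u l ≡ u′ l) → ∀ ν m → G u i M ν m ≡ G u′ i M ν m
G-cong i zero    e zero    zero    = refl
G-cong i zero    e zero    (suc m) = refl
G-cong i zero    e (suc ν) m       = refl
G-cong i (suc M) e ν       m       = ∑-cong (suc ν) λ j _ →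
  cong₂ _⊗_ (cong (λ z → divPow z j) (e i ℕₚ.≤-refl (ℕₚ.m<m+n i (s≤s z≤n))))
    (shift-cong (i * j) m (λ m′ _ → G-cong (suc i) M
      (λ l i<l l< → e l (ℕₚ.<⇒≤ i<l) (subst (l <_) (sym (ℕₚ.+-suc i M)) l<)) (ν ∸ j) m′))

private
  j≤ij : ∀ i j → 1 ≤ i → j ≤ i * j
  j≤ij (suc i) j _ = ℕₚ.m≤m+n j (i * j)

private
  -- Parts of size at least 1: removing j of them lowers the weight by at least j, so a strict bound
  -- on the weight may be lowered by j.
  weight-< : ∀ {i} j {m′ ν} → 1 ≤ i → i * j + m′ < ν → m′ < ν ∸ j
  weight-< {i} j {m′} {ν} 1≤i l = ℕₚ.m+n≤o⇒m≤o∸n (suc m′)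
    (ℕₚ.≤-trans (s≤s (ℕₚ.≤-trans (ℕₚ.≤-reflexive (ℕₚ.+-comm m′ j)) (ℕₚ.+-monoˡ-≤ m′ (j≤ij i j 1≤i)))) l)

-- A product of ν series without constant term has order at least ν.
G-small : ∀ u i M ν m → 1 ≤ i → m < ν → G u i M ν m ≡ 0ℚ
G-small u i zero    (suc ν) m _   _   = refl
G-small u i (suc M) ν       m 1≤i m<ν = ∑-zero (suc ν) λ j _ →
  trans (cong (divPow (u i) j ⊗_) (shift-zero (i * j) m λ m′ q →
      G-small u (suc i) M (ν ∸ j) m′ (s≤s z≤n) (weight-< j 1≤i (subst (_< ν) q m<ν))))
    (ℚₚ.*-zeroʳ (divPow (u i) j))

-- A part of size i + M together with ν - 1 further parts has weight at least i + M + ν - 1.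
G-extend : ∀ u i M ν m → 1 ≤ i → suc m < i + M + ν → G u i (suc M) ν m ≡ G u i M ν m
G-extend u i zero zero m 1≤i _ rewrite ℕₚ.*-zeroʳ i = trans (ℚₚ.+-identityʳ _) (trans (ℚₚ.*-identityˡ _) (δ m))
  where
  δ : ∀ m → G u (suc i) 0 0 m ≡ G u i 0 0 m
  δ zero    = refl
  δ (suc m) = refl
G-extend u i zero (suc ν) m 1≤i l = ∑-zero (suc (suc ν)) λ { j (s≤s j≤ν) →
  trans (cong (divPow (u i) j ⊗_) (shift-zero (i * j) m (vanish j j≤ν))) (ℚₚ.*-zeroʳ (divPow (u i) j)) }
  where
  -- This is (i - 1)ν ≥ 0. It excludes the only possible contribution, in which all ν + 1 parts have
  -- size i and m = i(ν + 1).
  bound : ∀ i → 1 ≤ i → i + suc ν ≤ suc (i * suc ν)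
  bound (suc i) _ = s≤s (ℕₚ.≤-trans (ℕₚ.≤-reflexive (ℕₚ.+-comm i (suc ν))) (ℕₚ.+-monoʳ-≤ (suc ν) (ℕₚ.m≤m*n i (suc ν))))
  vanish : ∀ j → j ≤ suc ν → ∀ m′ → m ≡ i * j + m′ → G u (suc i) 0 (suc ν ∸ j) m′ ≡ 0ℚ
  vanish j j≤ m′ q with suc ν ∸ j in eq
  vanish j j≤ m′ q       | suc _ = refl
  vanish j j≤ (suc m′) q | zero  = refl
  vanish j j≤ zero q     | zero  = contradiction (subst (suc m <_) (cong (_+ suc ν) (ℕₚ.+-identityʳ i)) l)
    (ℕₚ.≤⇒≯ (subst (λ z → i + suc ν ≤ suc z) (trans (cong (i *_) (ℕₚ.≤-antisym (ℕₚ.m∸n≡0⇒m≤n eq) j≤)) (trans (sym (ℕₚ.+-identityʳ (i * j))) (sym q))) (bound i 1≤i)))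
G-extend u i (suc M) ν m 1≤i l = ∑-cong (suc ν) λ { j (s≤s j≤ν) →
  cong (divPow (u i) j ⊗_) (shift-cong (i * j) m λ m′ q →
    G-extend u (suc i) M (ν ∸ j) m′ (s≤s z≤n) (step j j≤ν m′ q)) }
  where
  step : ∀ j → j ≤ ν → ∀ m′ → m ≡ i * j + m′ → suc m′ < suc i + M + (ν ∸ j)
  step j j≤ν m′ q = subst (suc m′ <_) (trans (ℕₚ.+-∸-assoc (i + suc M) j≤ν) (cong (_+ (ν ∸ j)) (ℕₚ.+-suc i M)))
    (weight-< j 1≤i (subst (_< i + suc M + ν) (trans (cong suc q) (sym (ℕₚ.+-suc (i * j) m′))) l))

G-extend-≤ : ∀ u i M M′ ν m → 1 ≤ i → M ≤ M′ → suc m < i + M + ν → G u i M′ ν m ≡ G u i M ν m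
G-extend-≤ u i M M′ ν m 1≤i M≤M′ l = go (ℕₚ.≤⇒≤′ M≤M′)
  where
  go : ∀ {M′} → M ℕ.≤′ M′ → G u i M′ ν m ≡ G u i M ν m
  go (ℕ.≤′-reflexive refl) = refl
  go (ℕ.≤′-step M≤′) = trans (G-extend u i _ ν m 1≤i
    (ℕₚ.<-≤-trans l (ℕₚ.+-monoˡ-≤ ν (ℕₚ.+-monoʳ-≤ i (ℕₚ.≤′⇒≤ M≤′))))) (go M≤′)

-- Stirling numbers of the first kind

coeff-addℤ : ∀ xs ys k → coeff (addℤ xs ys) k ≡ coeff xs k ℤ.+ coeff ys k
coeff-addℤ []       ys       k       = sym (ℤₚ.+-identityˡ (coeff ys k))
coeff-addℤ (x ∷ xs) []       k       = sym (ℤₚ.+-identityʳ (coeff (x ∷ xs) k))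
coeff-addℤ (x ∷ xs) (y ∷ ys) zero    = refl
coeff-addℤ (x ∷ xs) (y ∷ ys) (suc k) = coeff-addℤ xs ys k

coeff-scaleℤ : ∀ c xs k → coeff (scaleℤ c xs) k ≡ c ℤ.* coeff xs k
coeff-scaleℤ c []       k       = sym (ℤₚ.*-zeroʳ c)
coeff-scaleℤ c (x ∷ xs) zero    = refl
coeff-scaleℤ c (x ∷ xs) (suc k) = coeff-scaleℤ c xs k

stirling1-suc-zero : ∀ N → stirling1 (suc N) 0 ≡ + 0
stirling1-suc-zero N = trans (coeff-addℤ (+ 0 ∷ fallingPoly N) (scaleℤ (ℤ.- + N) (fallingPoly N)) 0)
  (trans (ℤₚ.+-identityˡ _) (trans (coeff-scaleℤ (ℤ.- + N) (fallingPoly N) 0) (vanish N)))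
  where
  vanish : ∀ N → ℤ.- + N ℤ.* stirling1 N 0 ≡ + 0
  vanish zero    = refl
  vanish (suc N) = trans (cong (ℤ.- + suc N ℤ.*_) (stirling1-suc-zero N)) (ℤₚ.*-zeroʳ (ℤ.- + suc N))

stirling1-suc-suc : ∀ N k → stirling1 (suc N) (suc k) ≡ stirling1 N k ℤ.+ (ℤ.- + N) ℤ.* stirling1 N (suc k)
stirling1-suc-suc N k = trans (coeff-addℤ (+ 0 ∷ fallingPoly N) (scaleℤ (ℤ.- + N) (fallingPoly N)) (suc k))
  (cong (λ z → stirling1 N k ℤ.+ z) (coeff-scaleℤ (ℤ.- + N) (fallingPoly N) (suc k)))

stirling1-> : ∀ N k → N < k → stirling1 N k ≡ + 0
stirling1-> zero    (suc k) _       = refl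
stirling1-> (suc N) (suc k) (s≤s l) = trans (stirling1-suc-suc N k)
  (trans (cong₂ (λ x y → x ℤ.+ (ℤ.- + N) ℤ.* y) (stirling1-> N k l) (stirling1-> N (suc k) (ℕₚ.m≤n⇒m≤1+n l)))
    (trans (ℤₚ.+-identityˡ _) (ℤₚ.*-zeroʳ (ℤ.- + N))))

-- x(x-1)⋯(x-ν) divided by x, evaluated at x = m + 1.
stirling1-falling : ∀ m ν → ν ≤ m →
  ∑ (suc ν) (λ k → ℤ→ℚ (stirling1 (suc ν) (suc k)) ⊗ powℚ (ℕ→ℚ (suc m)) k) ≡ ℕ→ℚ (m P′ ν)
stirling1-falling m zero    _   = refl
stirling1-falling m (suc ν) ν<m = begin
  ∑ (suc (suc ν)) (λ k → s (suc (suc ν)) (suc k) ⊗ powℚ x k)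
    ≡⟨ ∑-cong (suc (suc ν)) (λ k _ → expand k) ⟩
  ∑ (suc (suc ν)) (λ k → s (suc ν) k ⊗ powℚ x k ⊕ c ⊗ (s (suc ν) (suc k) ⊗ powℚ x k))
    ≡⟨ ∑-+ (suc (suc ν)) (λ k → s (suc ν) k ⊗ powℚ x k) (λ k → c ⊗ (s (suc ν) (suc k) ⊗ powℚ x k)) ⟩
  ∑ (suc (suc ν)) (λ k → s (suc ν) k ⊗ powℚ x k) ⊕ ∑ (suc (suc ν)) (λ k → c ⊗ (s (suc ν) (suc k) ⊗ powℚ x k))
    ≡⟨ cong₂ _⊕_ raised (∑-*ˡ (suc (suc ν)) c (λ k → s (suc ν) (suc k) ⊗ powℚ x k)) ⟩
  x ⊗ A ⊕ c ⊗ ∑ (suc (suc ν)) (λ k → s (suc ν) (suc k) ⊗ powℚ x k)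
    ≡⟨ cong (λ z → x ⊗ A ⊕ c ⊗ z) truncated ⟩
  x ⊗ A ⊕ c ⊗ A   ≡⟨ ℚₚ.*-distribʳ-+ A x c ⟨
  (x ⊕ c) ⊗ A     ≡⟨ cong₂ _⊗_ factor (stirling1-falling m ν (ℕₚ.<⇒≤ ν<m)) ⟩
  ℕ→ℚ (m ∸ ν) ⊗ ℕ→ℚ (m P′ ν) ≡⟨ ℕ→ℚ-* (m ∸ ν) (m P′ ν) ⟨
  ℕ→ℚ (m P′ suc ν) ∎
  where
  s : ℕ → ℕ → ℚ
  s N k = ℤ→ℚ (stirling1 N k)
  x = ℕ→ℚ (suc m)
  c = ⊝ ℕ→ℚ (suc ν)
  A = ∑ (suc ν) (λ k → s (suc ν) (suc k) ⊗ powℚ x k)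
  expand : ∀ k → s (suc (suc ν)) (suc k) ⊗ powℚ x k ≡ s (suc ν) k ⊗ powℚ x k ⊕ c ⊗ (s (suc ν) (suc k) ⊗ powℚ x k)
  expand k = begin
    s (suc (suc ν)) (suc k) ⊗ powℚ x k
      ≡⟨ cong (λ z → ℤ→ℚ z ⊗ powℚ x k) (stirling1-suc-suc (suc ν) k) ⟩
    ℤ→ℚ (stirling1 (suc ν) k ℤ.+ (ℤ.- + suc ν) ℤ.* stirling1 (suc ν) (suc k)) ⊗ powℚ x k
      ≡⟨ cong (_⊗ powℚ x k) (trans (ℤ→ℚ-+ (stirling1 (suc ν) k) _)
           (cong (s (suc ν) k ⊕_) (trans (ℤ→ℚ-* (ℤ.- + suc ν) (stirling1 (suc ν) (suc k))) (cong (_⊗ s (suc ν) (suc k)) (ℤ→ℚ-neg (+ suc ν)))))) ⟩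
    (s (suc ν) k ⊕ c ⊗ s (suc ν) (suc k)) ⊗ powℚ x k
      ≡⟨ solve 4 (λ a c b q → (a :+ c :* b) :* q := a :* q :+ c :* (b :* q)) refl (s (suc ν) k) c (s (suc ν) (suc k)) (powℚ x k) ⟩
    s (suc ν) k ⊗ powℚ x k ⊕ c ⊗ (s (suc ν) (suc k) ⊗ powℚ x k) ∎
  -- The falling factorial has no constant term, so the first summand vanishes and the others share
  -- a factor x.
  raised : ∑ (suc (suc ν)) (λ k → s (suc ν) k ⊗ powℚ x k) ≡ x ⊗ A
  raised = begin
    s (suc ν) 0 ⊗ 1ℚ ⊕ ∑ (suc ν) (λ k → s (suc ν) (suc k) ⊗ (x ⊗ powℚ x k))
      ≡⟨ cong₂ _⊕_ (cong (λ z → ℤ→ℚ z ⊗ 1ℚ) (stirling1-suc-zero ν))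
           (∑-cong (suc ν) (λ k _ → solve 3 (λ a b c → a :* (b :* c) := b :* (a :* c)) refl (s (suc ν) (suc k)) x (powℚ x k))) ⟩
    0ℚ ⊕ ∑ (suc ν) (λ k → x ⊗ (s (suc ν) (suc k) ⊗ powℚ x k)) ≡⟨ ℚₚ.+-identityˡ _ ⟩
    ∑ (suc ν) (λ k → x ⊗ (s (suc ν) (suc k) ⊗ powℚ x k)) ≡⟨ ∑-*ˡ (suc ν) x (λ k → s (suc ν) (suc k) ⊗ powℚ x k) ⟩
    x ⊗ A ∎
  truncated : ∑ (suc (suc ν)) (λ k → s (suc ν) (suc k) ⊗ powℚ x k) ≡ A
  truncated = ∑-truncate _ (ℕₚ.n≤1+n (suc ν)) λ k ν<k _ →
    trans (cong (λ z → ℤ→ℚ z ⊗ powℚ x k) (stirling1-> (suc ν) (suc k) (s≤s ν<k))) (ℚₚ.*-zeroˡ (powℚ x k))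
  factor : x ⊕ c ≡ ℕ→ℚ (m ∸ ν)
  factor = begin
    ℕ→ℚ (suc m) ⊕ c                     ≡⟨ cong (λ z → ℕ→ℚ (suc z) ⊕ c) (ℕₚ.m∸n+n≡m (ℕₚ.<⇒≤ ν<m)) ⟨
    ℕ→ℚ (suc (m ∸ ν + ν)) ⊕ c           ≡⟨ cong (λ z → ℕ→ℚ z ⊕ c) (ℕₚ.+-suc (m ∸ ν) ν) ⟨
    ℕ→ℚ (m ∸ ν + suc ν) ⊕ c             ≡⟨ cong (_⊕ c) (ℕ→ℚ-+ (m ∸ ν) (suc ν)) ⟩
    ℕ→ℚ (m ∸ ν) ⊕ ℕ→ℚ (suc ν) ⊕ c       ≡⟨ solve 2 (λ a b → a :+ b :+ (:- b) := a) refl (ℕ→ℚ (m ∸ ν)) (ℕ→ℚ (suc ν)) ⟩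
    ℕ→ℚ (m ∸ ν) ∎

-- `_P′_` is the recursive product that the Stirling induction produces; `_P_` is the guarded
-- version occurring in Ψ and in the formula for `_C_`.
nPk≡nP′k : ∀ {n k} → k ≤ n → n P k ≡ n P′ k
nPk≡nP′k k≤n = trans (nPk≡n!/[n∸k]! k≤n) (sym (nP′k≡n!/[n∸k]! k≤n))

nCk*k!≡nP′k : ∀ {n k} → k ≤ n → (n C k) * k ℕ.! ≡ n P′ k
nCk*k!≡nP′k {n} {k} k≤n = trans (cong (_* k ℕ.!) (trans (nCk≡nPk/k! k≤n) (/-congˡ {{k !≢0}} (nPk≡nP′k k≤n))))
  (m/n*n≡m {{k !≢0}} (k!∣nP′k k≤n))

nPk*[n∸k]!≡n! : ∀ {n k} → k ≤ n → (n P k) * (n ∸ k) ℕ.! ≡ n ℕ.!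
nPk*[n∸k]!≡n! {n} {k} k≤n = trans (cong (_* (n ∸ k) ℕ.!) (nPk≡n!/[n∸k]! k≤n))
  (m/n*n≡m {{(n ∸ k) !≢0}} (m≤n⇒m!∣n! (ℕₚ.m∸n≤m n k)))

-- The recurrence for ψ_ν/ν!

≤ᵇ-true : ∀ {i N} → i ≤ N → (i ≤ᵇ N) ≡ true
≤ᵇ-true {i} {N} i≤N with i ≤ᵇ N | ℕₚ.≤⇒≤ᵇ i≤N
... | true | _ = refl

psiUpTo-psi : ∀ x N i → i ≤ N → psiUpTo x N i ≡ psi x i
psiUpTo-psi x zero    zero _ = refl
psiUpTo-psi x (suc N) i i≤sN with ℕₚ.m≤n⇒m<n∨m≡n i≤sN
... | inj₂ refl = refl
... | inj₁ (s≤s i≤N) rewrite ≤ᵇ-true i≤N = psiUpTo-psi x N i i≤N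

psi-suc : ∀ x N → psi x (suc N) ≡ psiStep (suc N) x (psiUpTo x N)
psi-suc x N with suc N ≤ᵇ N in eq
... | false = refl
... | true  with () ← ℕₚ.1+n≰n (ℕₚ.≤ᵇ⇒≤ (suc N) N (subst T (sym eq) _))

s₁ : ℕ → ℕ → ℚ
s₁ ν k = ℤ→ℚ (stirling1 (suc ν) (suc k))

-- The coefficient of tᵐ in (t-1)(t-2)⋯(t-ν) · (Σ u_l tˡ)^ν/ν!, with l running over 1, ..., M. This
-- is the series behind the ν-th summand of Ψ, up to sign.
H : (ℕ → ℚ) → ℕ → ℕ → ℕ → ℚ
H u M ν m = ∑ (suc ν) (λ k → s₁ ν k ⊗ shift k (G u 1 M ν) m)

H-small : ∀ u M ν m → m < ν → H u M ν m ≡ 0ℚ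
H-small u M ν m m<ν = ∑-zero (suc ν) λ k _ → trans (cong (s₁ ν k ⊗_) (shift-zero k m λ m′ q →
  G-small u 1 M ν m′ ℕₚ.≤-refl (ℕₚ.≤-<-trans (subst (m′ ≤_) (sym q) (ℕₚ.m≤n+m m′ k)) m<ν))) (ℚₚ.*-zeroʳ (s₁ ν k))

-- The factorial (N+1-k)! of the Bell polynomial and the falling factorial (N+1)_k multiply to
-- (N+1)!, which the prefactor cancels. The number of variables, which depends on k and ν, is then
-- replaced by the uniform M.
bellPartial-psi : ∀ x N M ν k → N ≤ M → 2 ≤ ν → k + ν ≤ suc N →
  invFact (suc N) ⊗ (ℕ→ℚ (suc N P k) ⊗ bellPartial (suc N ∸ k) ν (psiUpTo x N))
    ≡ shift k (G (scaled (psi x)) 1 M ν) (suc N)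
bellPartial-psi x N M ν k N≤M 2≤ν k+ν≤ = begin
  invFact (suc N) ⊗ (ℕ→ℚ (suc N P k) ⊗ bellPartial m ν (psiUpTo x N))
    ≡⟨ cong (λ z → invFact (suc N) ⊗ (ℕ→ℚ (suc N P k) ⊗ z)) (bellPartial-G m ν (psiUpTo x N) ν≤m) ⟩
  invFact (suc N) ⊗ (ℕ→ℚ (suc N P k) ⊗ (ℕ→ℚ (m ℕ.!) ⊗ g))
    ≡⟨ solve 4 (λ a b c d → a :* (b :* (c :* d)) := a :* (b :* c) :* d) refl (invFact (suc N)) (ℕ→ℚ (suc N P k)) (ℕ→ℚ (m ℕ.!)) g ⟩
  invFact (suc N) ⊗ (ℕ→ℚ (suc N P k) ⊗ ℕ→ℚ (m ℕ.!)) ⊗ g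
    ≡⟨ cong (λ z → invFact (suc N) ⊗ z ⊗ g) (trans (sym (ℕ→ℚ-* (suc N P k) (m ℕ.!))) (cong ℕ→ℚ (nPk*[n∸k]!≡n! k≤))) ⟩
  invFact (suc N) ⊗ ℕ→ℚ (suc N ℕ.!) ⊗ g ≡⟨ cong (_⊗ g) (invFact-! (suc N)) ⟩
  1ℚ ⊗ g                                ≡⟨ ℚₚ.*-identityˡ g ⟩
  g                                     ≡⟨ G-cong 1 len (λ l _ l< → cong (_⊗ invFact l) (psiUpTo-psi x N l (ℕₚ.≤-trans (ℕ.s≤s⁻¹ l<) len≤N))) ν m ⟩
  G (scaled (psi x)) 1 len ν m          ≡⟨ G-extend-≤ (scaled (psi x)) 1 len M ν m ℕₚ.≤-refl (ℕₚ.≤-trans len≤N N≤M) long ⟨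
  G (scaled (psi x)) 1 M ν m            ≡⟨ shift-≤ k (G (scaled (psi x)) 1 M ν) (suc N) k≤ ⟨
  shift k (G (scaled (psi x)) 1 M ν) (suc N) ∎
  where
  m len : ℕ
  m = suc N ∸ k
  len = m ∸ ν + 1
  g : ℚ
  g = G (scaled (psiUpTo x N)) 1 len ν m
  k≤ : k ≤ suc N
  k≤ = ℕₚ.m+n≤o⇒m≤o k k+ν≤
  ν≤m : ν ≤ m
  ν≤m = ℕₚ.m+n≤o⇒m≤o∸n ν (subst (_≤ suc N) (ℕₚ.+-comm k ν) k+ν≤)
  len+ν : len + ν ≡ suc m
  len+ν = trans (cong (_+ ν) (ℕₚ.+-comm (m ∸ ν) 1)) (cong suc (ℕₚ.m∸n+n≡m ν≤m))
  -- The largest part of m in ν parts is m - ν + 1 = `len`, so further variables cannot contribute;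
  -- the bound is tight.
  long : suc m < 1 + len + ν
  long = s≤s (ℕₚ.≤-reflexive (sym len+ν))
  -- This is where ν ≥ 2 enters: only ψ_1, ..., ψ_N occur, on which `psiUpTo x N` agrees with
  -- `psi x`.
  len≤N : len ≤ N
  len≤N = ℕₚ.+-cancelʳ-≤ 2 len N (ℕₚ.≤-trans (ℕₚ.+-monoʳ-≤ len 2≤ν)
    (ℕₚ.≤-trans (ℕₚ.≤-reflexive len+ν) (ℕₚ.≤-trans (s≤s (ℕₚ.m∸n≤m (suc N) k)) (ℕₚ.≤-reflexive (ℕₚ.+-comm 2 N)))))

PsiTerm-H : ∀ x N M → N ≤ M →
  invFact (suc N) ⊗ PsiTerm (suc N) (psiUpTo x N)
    ≡ ∑ N (λ i → sgn (3 + i) ⊗ H (scaled (psi x)) M (2 + i) (suc N))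
PsiTerm-H x N M N≤M = begin
  I ⊗ PsiTerm (suc N) prev ≡⟨ cong (I ⊗_) (Σ[⋯]-∑ 2 (suc N) _) ⟩
  I ⊗ ∑ N (λ i → inner (2 + i)) ≡⟨ ∑-*ˡ N I (λ i → inner (2 + i)) ⟨
  ∑ N (λ i → I ⊗ inner (2 + i)) ≡⟨ ∑-cong N (λ i i<N → each (2 + i) (s≤s (s≤s z≤n)) (s≤s i<N)) ⟩
  ∑ N (λ i → sgn (3 + i) ⊗ H u M (2 + i) (suc N)) ∎
  where
  I = invFact (suc N)
  u prev : ℕ → ℚ
  u = scaled (psi x)
  prev = psiUpTo x N
  summand : ℕ → ℕ → ℚ
  summand ν k = sgn (ν + 1) ⊗ ℤ→ℚ (stirling1 (ν + 1) (k + 1)) ⊗ ℕ→ℚ (suc N P k) ⊗ bellPartial (suc N ∸ k) ν prev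
  inner : ℕ → ℚ
  inner ν = Σ[ 0 ⋯ ν ⊓ (suc N ∸ ν) ] (summand ν)
  each : ∀ ν → 2 ≤ ν → ν ≤ suc N → I ⊗ inner ν ≡ sgn (suc ν) ⊗ H u M ν (suc N)
  each ν 2≤ν ν≤ = begin
    I ⊗ inner ν ≡⟨ cong (I ⊗_) (Σ[⋯]-∑ 0 (ν ⊓ (suc N ∸ ν)) (summand ν)) ⟩
    I ⊗ ∑ (suc (ν ⊓ (suc N ∸ ν))) (summand ν) ≡⟨ ∑-*ˡ (suc (ν ⊓ (suc N ∸ ν))) I (summand ν) ⟨
    ∑ (suc (ν ⊓ (suc N ∸ ν))) (λ k → I ⊗ summand ν k) ≡⟨ ∑-cong (suc (ν ⊓ (suc N ∸ ν))) (λ { k (s≤s k≤) → term k k≤ }) ⟩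
    ∑ (suc (ν ⊓ (suc N ∸ ν))) (λ k → sgn (suc ν) ⊗ h k) ≡⟨ ∑-*ˡ (suc (ν ⊓ (suc N ∸ ν))) (sgn (suc ν)) h ⟩
    sgn (suc ν) ⊗ ∑ (suc (ν ⊓ (suc N ∸ ν))) h
      ≡⟨ cong (sgn (suc ν) ⊗_) (∑-truncate h (s≤s (ℕₚ.m⊓n≤m ν (suc N ∸ ν))) vanish) ⟨
    sgn (suc ν) ⊗ H u M ν (suc N) ∎
    where
    h : ℕ → ℚ
    h k = s₁ ν k ⊗ shift k (G u 1 M ν) (suc N)
    term : ∀ k → k ≤ ν ⊓ (suc N ∸ ν) → I ⊗ summand ν k ≡ sgn (suc ν) ⊗ h k
    term k k≤ = begin
      I ⊗ summand ν k
        ≡⟨ cong₂ (λ a b → I ⊗ (sgn a ⊗ ℤ→ℚ (stirling1 a b) ⊗ ℕ→ℚ (suc N P k) ⊗ bellPartial (suc N ∸ k) ν prev)) (ℕₚ.+-comm ν 1) (ℕₚ.+-comm k 1) ⟩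
      I ⊗ (sgn (suc ν) ⊗ s₁ ν k ⊗ ℕ→ℚ (suc N P k) ⊗ bellPartial (suc N ∸ k) ν prev)
        ≡⟨ solve 5 (λ i a b c d → i :* (a :* b :* c :* d) := a :* (b :* (i :* (c :* d)))) refl
             I (sgn (suc ν)) (s₁ ν k) (ℕ→ℚ (suc N P k)) (bellPartial (suc N ∸ k) ν prev) ⟩
      sgn (suc ν) ⊗ (s₁ ν k ⊗ (I ⊗ (ℕ→ℚ (suc N P k) ⊗ bellPartial (suc N ∸ k) ν prev)))
        ≡⟨ cong (λ z → sgn (suc ν) ⊗ (s₁ ν k ⊗ z)) (bellPartial-psi x N M ν k N≤M 2≤ν
             (ℕₚ.≤-trans (ℕₚ.+-monoˡ-≤ ν (ℕₚ.≤-trans k≤ (ℕₚ.m⊓n≤n ν (suc N ∸ ν)))) (ℕₚ.≤-reflexive (ℕₚ.m∸n+n≡m ν≤)))) ⟩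
      sgn (suc ν) ⊗ h k ∎
    -- An index k ≤ ν beyond the minimum satisfies N + 1 - k < ν, and there the ν-th power has no
    -- coefficient. So the range in Ψ may be enlarged to all k ≤ ν.
    vanish : ∀ k → suc (ν ⊓ (suc N ∸ ν)) ≤ k → k < suc ν → h k ≡ 0ℚ
    vanish k lo (s≤s k≤ν) = trans (cong (s₁ ν k ⊗_) (shift-zero k (suc N) λ m′ q →
        G-small u 1 M ν m′ ℕₚ.≤-refl (ℕₚ.≰⇒> λ ν≤m′ → ℕₚ.<⇒≱ lo (ℕₚ.⊓-glb k≤ν
          (ℕₚ.m+n≤o⇒m≤o∸n k (ℕₚ.≤-trans (ℕₚ.+-monoʳ-≤ k ν≤m′) (ℕₚ.≤-reflexive (sym q))))))))
      (ℚₚ.*-zeroʳ (s₁ ν k))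

-- Both M (number of variables) and q (number of summands ν = 2, ..., q + 1) are free upper bounds,
-- since the surplus vanishes. M = N shows that only earlier values occur; bounds common to all
-- degrees allow the sums over the degree and over ν to be interchanged.
scaled-psi-suc : ∀ x M q N → N ≤ M → N ≤ q →
  scaled (psi x) (suc N) ≡ scaled (psi x) N ⊕ sigmaHat x (suc N) ⊕ ∑ q (λ i → sgn (3 + i) ⊗ H (scaled (psi x)) M (2 + i) (suc N))
scaled-psi-suc x M q N N≤M N≤q = begin
  psi x (suc N) ⊗ I ≡⟨ cong (_⊗ I) (psi-suc x N) ⟩
  (ℕ→ℚ (suc N) ⊗ psi x N ⊕ sigmaStar x (suc N) ⊕ Ψ) ⊗ I
    ≡⟨ solve 5 (λ n y s t i → (n :* y :+ s :+ t) :* i := y :* (n :* i) :+ s :* i :+ i :* t) refl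
         (ℕ→ℚ (suc N)) (psi x N) (sigmaStar x (suc N)) Ψ I ⟩
  psi x N ⊗ (ℕ→ℚ (suc N) ⊗ I) ⊕ sigmaHat x (suc N) ⊕ I ⊗ Ψ
    ≡⟨ cong₂ (λ a b → psi x N ⊗ a ⊕ sigmaHat x (suc N) ⊕ b) (suc-invFact N) (trans (PsiTerm-H x N M N≤M) (sym extended)) ⟩
  scaled (psi x) N ⊕ sigmaHat x (suc N) ⊕ ∑ q (λ i → sgn (3 + i) ⊗ H (scaled (psi x)) M (2 + i) (suc N)) ∎
  where
  I = invFact (suc N)
  Ψ = PsiTerm (suc N) (psiUpTo x N)
  extended : ∑ q (λ i → sgn (3 + i) ⊗ H (scaled (psi x)) M (2 + i) (suc N)) ≡ ∑ N (λ i → sgn (3 + i) ⊗ H (scaled (psi x)) M (2 + i) (suc N))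
  extended = ∑-truncate _ N≤q λ i N≤i _ →
    trans (cong (sgn (3 + i) ⊗_) (H-small (scaled (psi x)) M (2 + i) (suc N) (s≤s (s≤s N≤i)))) (ℚₚ.*-zeroʳ (sgn (3 + i)))

-- B_1(-x_1) = -x_1, and the outer sign cancels. This produces the leading term Q_p(1) of the
-- congruence.
sigmaHat-1 : ∀ x → sigmaHat x 1 ≡ x 1
sigmaHat-1 x = begin
  sgn 1 ⊗ (bellPartial 1 1 y ⊕ 0ℚ) ⊗ 1ℚ ≡⟨ cong (λ z → sgn 1 ⊗ (z ⊕ 0ℚ) ⊗ 1ℚ) (bellPartial-G 1 1 y ℕₚ.≤-refl) ⟩
  sgn 1 ⊗ (1ℚ ⊗ (1ℚ ⊗ 1ℚ ⊗ 0ℚ ⊕ (y 1 ⊗ 1ℚ ⊗ 1ℚ ⊗ 1ℚ ⊗ 1ℚ ⊕ 0ℚ)) ⊕ 0ℚ) ⊗ 1ℚ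
    ≡⟨ solve 1 (λ a → con (⊝ 1ℚ) :* (con 1ℚ :* (con 1ℚ :* con 1ℚ :* con 0ℚ :+ ((:- (con 1ℚ :* a)) :* con 1ℚ :* con 1ℚ :* con 1ℚ :* con 1ℚ :+ con 0ℚ)) :+ con 0ℚ) :* con 1ℚ := a) refl (x 1) ⟩
  x 1 ∎
  where
  y : ℕ → ℚ
  y i = ⊝ (ℕ→ℚ ((i ∸ 1) ℕ.!) ⊗ x i)

sgn-+2 : ∀ k → sgn (2 + k) ≡ sgn k
sgn-+2 k = solve 1 (λ s → con (⊝ 1ℚ) :* (con (⊝ 1ℚ) :* s) := s) refl (sgn k)

-- Rationals with denominator prime to p

num-den : ∀ c → c ⊗ ℕ→ℚ (ℚ.denominatorℕ c) ≡ ℤ→ℚ (ℚ.numerator c)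
num-den c@record{} = trans (cong (_⊗ ℕ→ℚ (ℚ.denominatorℕ c)) (sym (ℚₚ.↥p/↧p≡p c))) (/-*-cancel (ℚ.numerator c) (ℚ.denominatorℕ c))

-- Cross-multiplication makes the reduced denominator divide numerator times d, and it is coprime to
-- the numerator. So any fraction with denominator prime to p certifies `pIntegral`.
denominator-∣ : ∀ c z d → c ⊗ ℕ→ℚ d ≡ ℤ→ℚ z → ℚ.denominatorℕ c ∣ d
denominator-∣ c@(Q.mkℚ n d-1 cop) z d e = coprime-divisor {n = ℤ.∣ n ∣} (Coprimality.sym (Coprimality.recompute cop))
  (divides ℤ.∣ z ∣ (begin
    ℤ.∣ n ∣ * d        ≡⟨ ℤₚ.abs-* n (+ d) ⟨
    ℤ.∣ n ℤ.* + d ∣    ≡⟨ cong ℤ.∣_∣ cross ⟩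
    ℤ.∣ z ℤ.* + suc d-1 ∣ ≡⟨ ℤₚ.abs-* z (+ suc d-1) ⟩
    ℤ.∣ z ∣ * suc d-1  ∎))
  where
  D = ℕ→ℚ (suc d-1)
  cross : n ℤ.* + d ≡ z ℤ.* + suc d-1
  cross = ℤ→ℚ-injective (begin
    ℤ→ℚ (n ℤ.* + d)      ≡⟨ ℤ→ℚ-* n (+ d) ⟩
    ℤ→ℚ n ⊗ ℕ→ℚ d        ≡⟨ cong (_⊗ ℕ→ℚ d) (num-den c) ⟨
    c ⊗ D ⊗ ℕ→ℚ d        ≡⟨ solve 3 (λ x y w → x :* y :* w := x :* w :* y) refl c D (ℕ→ℚ d) ⟩
    c ⊗ ℕ→ℚ d ⊗ D        ≡⟨ cong (_⊗ D) e ⟩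
    ℤ→ℚ z ⊗ D            ≡⟨ ℤ→ℚ-* z (+ suc d-1) ⟨
    ℤ→ℚ (z ℤ.* + suc d-1) ∎)

module Localization {p : ℕ} (pp : Prime p) where

  private instance
    p≢0 : NonZero p
    p≢0 = prime⇒nonZero pp

  pℚ : ℚ
  pℚ = ℕ→ℚ p

  suc[p∸1]≡p : suc (p ∸ 1) ≡ p
  suc[p∸1]≡p = ℕₚ.m+[n∸m]≡n (ℕ.>-nonZero⁻¹ p)

  -- `pIntegral` speaks of the reduced denominator, which is hard to follow through sums and
  -- products. Here any fraction with denominator prime to p will do, so closure is immediate.
  record Integral (c : ℚ) : Set where
    constructor integral
    field
      num    : ℤ
      den    : ℕ
      p∤den  : ¬ (p ∣ den)
      equal  : c ⊗ ℕ→ℚ den ≡ ℤ→ℚ num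

  p∤1 : ¬ (p ∣ 1)
  p∤1 p∣1 = ℕ.nonTrivial⇒≢1 {{prime⇒nonTrivial pp}} (∣1⇒≡1 p∣1)

  p∤-* : ∀ {a b} → ¬ (p ∣ a) → ¬ (p ∣ b) → ¬ (p ∣ a * b)
  p∤-* {a} {b} p∤a p∤b d = [ p∤a , p∤b ]′ (euclidsLemma a b pp d)

  p∤-< : ∀ {a} .{{_ : NonZero a}} → a < p → ¬ (p ∣ a)
  p∤-< a<p p∣a = ℕₚ.<⇒≱ a<p (∣⇒≤ p∣a)

  p∤! : ∀ k → k < p → ¬ (p ∣ k ℕ.!)
  p∤! zero    _   = p∤1
  p∤! (suc k) k<p = p∤-* (p∤-< k<p) (p∤! k (ℕₚ.<⇒≤ k<p))

  pIntegral⇒Integral : ∀ {c} → pIntegral p c → Integral c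
  pIntegral⇒Integral {c} h = integral (ℚ.numerator c) (ℚ.denominatorℕ c) h (num-den c)

  Integral⇒pIntegral : ∀ {c} → Integral c → pIntegral p c
  Integral⇒pIntegral {c} (integral z d p∤d e) p∣ = p∤d (∣-trans p∣ (denominator-∣ c z d e))

  I-ℤ : ∀ z → Integral (ℤ→ℚ z)
  I-ℤ z = integral z 1 p∤1 (ℚₚ.*-identityʳ (ℤ→ℚ z))

  I-ℕ : ∀ n → Integral (ℕ→ℚ n)
  I-ℕ n = I-ℤ (+ n)

  I-+ : ∀ {a b} → Integral a → Integral b → Integral (a ⊕ b)
  I-+ {a} {b} (integral z d p∤d e) (integral z′ d′ p∤d′ e′) =
    integral (z ℤ.* + d′ ℤ.+ z′ ℤ.* + d) (d * d′) (p∤-* p∤d p∤d′) (begin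
      (a ⊕ b) ⊗ ℕ→ℚ (d * d′)       ≡⟨ cong ((a ⊕ b) ⊗_) (ℕ→ℚ-* d d′) ⟩
      (a ⊕ b) ⊗ (ℕ→ℚ d ⊗ ℕ→ℚ d′)   ≡⟨ solve 4 (λ a b c d → (a :+ b) :* (c :* d) := a :* c :* d :+ b :* d :* c) refl a b (ℕ→ℚ d) (ℕ→ℚ d′) ⟩
      a ⊗ ℕ→ℚ d ⊗ ℕ→ℚ d′ ⊕ b ⊗ ℕ→ℚ d′ ⊗ ℕ→ℚ d ≡⟨ cong₂ (λ x y → x ⊗ ℕ→ℚ d′ ⊕ y ⊗ ℕ→ℚ d) e e′ ⟩
      ℤ→ℚ z ⊗ ℕ→ℚ d′ ⊕ ℤ→ℚ z′ ⊗ ℕ→ℚ d         ≡⟨ cong₂ _⊕_ (ℤ→ℚ-* z (+ d′)) (ℤ→ℚ-* z′ (+ d)) ⟨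
      ℤ→ℚ (z ℤ.* + d′) ⊕ ℤ→ℚ (z′ ℤ.* + d)     ≡⟨ ℤ→ℚ-+ (z ℤ.* + d′) (z′ ℤ.* + d) ⟨
      ℤ→ℚ (z ℤ.* + d′ ℤ.+ z′ ℤ.* + d)         ∎)

  I-* : ∀ {a b} → Integral a → Integral b → Integral (a ⊗ b)
  I-* {a} {b} (integral z d p∤d e) (integral z′ d′ p∤d′ e′) =
    integral (z ℤ.* z′) (d * d′) (p∤-* p∤d p∤d′) (begin
      a ⊗ b ⊗ ℕ→ℚ (d * d′)       ≡⟨ cong (a ⊗ b ⊗_) (ℕ→ℚ-* d d′) ⟩
      a ⊗ b ⊗ (ℕ→ℚ d ⊗ ℕ→ℚ d′)   ≡⟨ solve 4 (λ a b c d → a :* b :* (c :* d) := a :* c :* (b :* d)) refl a b (ℕ→ℚ d) (ℕ→ℚ d′) ⟩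
      a ⊗ ℕ→ℚ d ⊗ (b ⊗ ℕ→ℚ d′)   ≡⟨ cong₂ _⊗_ e e′ ⟩
      ℤ→ℚ z ⊗ ℤ→ℚ z′             ≡⟨ ℤ→ℚ-* z z′ ⟨
      ℤ→ℚ (z ℤ.* z′)             ∎)

  I-neg : ∀ {a} → Integral a → Integral (⊝ a)
  I-neg {a} (integral z d p∤d e) = integral (ℤ.- z) d p∤d (trans (sym (ℚₚ.neg-distribˡ-* a (ℕ→ℚ d))) (trans (cong ⊝_ e) (sym (ℤ→ℚ-neg z))))

  I-pow : ∀ {a} k → Integral a → Integral (powℚ a k)
  I-pow zero    h = I-ℕ 1
  I-pow (suc k) h = I-* h (I-pow k h)

  I-∑ : ∀ n {f : ℕ → ℚ} → (∀ i → i < n → Integral (f i)) → Integral (∑ n f)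
  I-∑ zero    h = I-ℕ 0
  I-∑ (suc n) h = I-+ (h 0 (s≤s z≤n)) (I-∑ n (λ i i<n → h (suc i) (s≤s i<n)))

  I-cancel : ∀ a {x} → ¬ (p ∣ a) → Integral (ℕ→ℚ a ⊗ x) → Integral x
  I-cancel a {x} p∤a (integral z d p∤d e) = integral z (a * d) (p∤-* p∤a p∤d) (begin
    x ⊗ ℕ→ℚ (a * d)       ≡⟨ cong (x ⊗_) (ℕ→ℚ-* a d) ⟩
    x ⊗ (ℕ→ℚ a ⊗ ℕ→ℚ d)   ≡⟨ solve 3 (λ x a d → x :* (a :* d) := a :* x :* d) refl x (ℕ→ℚ a) (ℕ→ℚ d) ⟩
    ℕ→ℚ a ⊗ x ⊗ ℕ→ℚ d     ≡⟨ e ⟩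
    ℤ→ℚ z                 ∎)

  I-invFact : ∀ k → k < p → Integral (invFact k)
  I-invFact k k<p = I-cancel (k ℕ.!) (p∤! k k<p) (subst Integral (sym (!-invFact k)) (I-ℕ 1))

  I-divPow : ∀ {a} k → k < p → Integral a → Integral (divPow a k)
  I-divPow k k<p h = I-* (I-pow k h) (I-invFact k k<p)

  I-shift : ∀ s {f : ℕ → ℚ} m → (∀ m′ → m′ ≤ m → Integral (f m′)) → Integral (shift s f m)
  I-shift zero    m       h = h m ℕₚ.≤-refl
  I-shift (suc s) zero    h = I-ℕ 0
  I-shift (suc s) (suc m) h = I-shift s m (λ m′ m′≤m → h m′ (ℕₚ.m≤n⇒m≤1+n m′≤m))

  I-G : ∀ u i M ν → ν < p → (∀ l → i ≤ l → l < i + M → Integral (u l)) → ∀ m → Integral (G u i M ν m)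
  I-G u i zero    zero    _   h zero    = I-ℕ 1
  I-G u i zero    zero    _   h (suc m) = I-ℕ 0
  I-G u i zero    (suc ν) _   h m       = I-ℕ 0
  I-G u i (suc M) ν       ν<p h m       = I-∑ (suc ν) λ { j (s≤s j≤ν) →
    I-* (I-divPow j (ℕₚ.≤-<-trans j≤ν ν<p) (h i ℕₚ.≤-refl (ℕₚ.m<m+n i (s≤s z≤n))))
        (I-shift (i * j) m (λ m′ _ → I-G u (suc i) M (ν ∸ j) (ℕₚ.≤-<-trans (ℕₚ.m∸n≤m ν j) ν<p)
          (λ l i<l l< → h l (ℕₚ.<⇒≤ i<l) (subst (l <_) (sym (ℕₚ.+-suc i M)) l<)) m′)) }

  -- Congruences modulo powers of p

  infix 4 _≈[_]_

  record _≈[_]_ (a : ℚ) (ℓ : ℕ) (b : ℚ) : Set where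
    constructor congruent
    field
      quot     : ℚ
      quot-int : Integral quot
      diff     : a ⊖ b ≡ powℚ pℚ ℓ ⊗ quot

  ≡⇒≈ : ∀ {a b ℓ} → a ≡ b → a ≈[ ℓ ] b
  ≡⇒≈ {a} {.a} {ℓ} refl = congruent 0ℚ (I-ℕ 0) (trans (ℚₚ.+-inverseʳ a) (sym (ℚₚ.*-zeroʳ (powℚ pℚ ℓ))))

  ≈-sym : ∀ {a b ℓ} → a ≈[ ℓ ] b → b ≈[ ℓ ] a
  ≈-sym {a} {b} {ℓ} (congruent c i e) = congruent (⊝ c) (I-neg i)
    (trans (solve 2 (λ a b → b :- a := :- (a :- b)) refl a b) (trans (cong ⊝_ e) (ℚₚ.neg-distribʳ-* (powℚ pℚ ℓ) c)))

  ≈-trans : ∀ {a b c ℓ} → a ≈[ ℓ ] b → b ≈[ ℓ ] c → a ≈[ ℓ ] c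
  ≈-trans {a} {b} {c} {ℓ} (congruent x i e) (congruent y j f) = congruent (x ⊕ y) (I-+ i j)
    (trans (solve 3 (λ a b c → a :- c := (a :- b) :+ (b :- c)) refl a b c)
      (trans (cong₂ _⊕_ e f) (sym (ℚₚ.*-distribˡ-+ (powℚ pℚ ℓ) x y))))

  ≈-+ : ∀ {a b c d ℓ} → a ≈[ ℓ ] b → c ≈[ ℓ ] d → a ⊕ c ≈[ ℓ ] b ⊕ d
  ≈-+ {a} {b} {c} {d} {ℓ} (congruent x i e) (congruent y j f) = congruent (x ⊕ y) (I-+ i j)
    (trans (solve 4 (λ a b c d → (a :+ c) :- (b :+ d) := (a :- b) :+ (c :- d)) refl a b c d)
      (trans (cong₂ _⊕_ e f) (sym (ℚₚ.*-distribˡ-+ (powℚ pℚ ℓ) x y))))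

  ≈-*ˡ : ∀ {a b c ℓ} → Integral c → a ≈[ ℓ ] b → c ⊗ a ≈[ ℓ ] c ⊗ b
  ≈-*ˡ {a} {b} {c} {ℓ} h (congruent x i e) = congruent (c ⊗ x) (I-* h i)
    (trans (solve 3 (λ a b c → c :* a :- c :* b := c :* (a :- b)) refl a b c)
      (trans (cong (c ⊗_) e) (solve 3 (λ a b c → a :* (b :* c) := b :* (a :* c)) refl c (powℚ pℚ ℓ) x)))

  -- From ac - bd = c(a - b) + b(c - d): just c and b have to be p-integral.
  ≈-* : ∀ {a b c d ℓ} → Integral c → Integral b → a ≈[ ℓ ] b → c ≈[ ℓ ] d → a ⊗ c ≈[ ℓ ] b ⊗ d
  ≈-* {a} {b} {c} {d} hc hb e f =
    ≈-trans (subst₂ (_≈[ _ ]_) (ℚₚ.*-comm c a) (ℚₚ.*-comm c b) (≈-*ˡ hc e)) (≈-*ˡ hb f)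

  ≈-pow : ∀ {a b ℓ} k → Integral a → Integral b → a ≈[ ℓ ] b → powℚ a k ≈[ ℓ ] powℚ b k
  ≈-pow zero    ha hb e = ≡⇒≈ refl
  ≈-pow (suc k) ha hb e = ≈-* (I-pow k ha) hb e (≈-pow k ha hb e)

  ≈-∑ : ∀ n {f g : ℕ → ℚ} {ℓ} → (∀ i → i < n → f i ≈[ ℓ ] g i) → ∑ n f ≈[ ℓ ] ∑ n g
  ≈-∑ zero    e = ≡⇒≈ refl
  ≈-∑ (suc n) e = ≈-+ (e 0 (s≤s z≤n)) (≈-∑ n (λ i i<n → e (suc i) (s≤s i<n)))

  ≈-raise : ∀ {a b ℓ} k → a ≈[ ℓ ] b → powℚ pℚ k ⊗ a ≈[ k + ℓ ] powℚ pℚ k ⊗ b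
  ≈-raise {a} {b} {ℓ} k (congruent x i e) = congruent x i (begin
    powℚ pℚ k ⊗ a ⊖ powℚ pℚ k ⊗ b  ≡⟨ solve 3 (λ a b c → c :* a :- c :* b := c :* (a :- b)) refl a b (powℚ pℚ k) ⟩
    powℚ pℚ k ⊗ (a ⊖ b)           ≡⟨ cong (powℚ pℚ k ⊗_) e ⟩
    powℚ pℚ k ⊗ (powℚ pℚ ℓ ⊗ x)    ≡⟨ ℚₚ.*-assoc (powℚ pℚ k) (powℚ pℚ ℓ) x ⟨
    powℚ pℚ k ⊗ powℚ pℚ ℓ ⊗ x      ≡⟨ cong (_⊗ x) (powℚ-+ pℚ k ℓ) ⟨
    powℚ pℚ (k + ℓ) ⊗ x           ∎)

  ≈-weaken : ∀ {a b ℓ ℓ′} → ℓ ≤ ℓ′ → a ≈[ ℓ′ ] b → a ≈[ ℓ ] b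
  ≈-weaken {a} {b} {ℓ} {ℓ′} ℓ≤ℓ′ (congruent x i e) = congruent (powℚ pℚ (ℓ′ ∸ ℓ) ⊗ x) (I-* (I-pow (ℓ′ ∸ ℓ) (I-ℕ p)) i) (begin
    a ⊖ b                             ≡⟨ e ⟩
    powℚ pℚ ℓ′ ⊗ x                     ≡⟨ cong (λ z → powℚ pℚ z ⊗ x) (ℕₚ.m+[n∸m]≡n ℓ≤ℓ′) ⟨
    powℚ pℚ (ℓ + (ℓ′ ∸ ℓ)) ⊗ x         ≡⟨ cong (_⊗ x) (powℚ-+ pℚ ℓ (ℓ′ ∸ ℓ)) ⟩
    powℚ pℚ ℓ ⊗ powℚ pℚ (ℓ′ ∸ ℓ) ⊗ x    ≡⟨ ℚₚ.*-assoc (powℚ pℚ ℓ) (powℚ pℚ (ℓ′ ∸ ℓ)) x ⟩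
    powℚ pℚ ℓ ⊗ (powℚ pℚ (ℓ′ ∸ ℓ) ⊗ x)  ∎)

  ≈-cancel : ∀ {a b ℓ} → pℚ ⊗ a ≈[ suc ℓ ] pℚ ⊗ b → a ≈[ ℓ ] b
  ≈-cancel {a} {b} {ℓ} (congruent x i e) = congruent x i (ℕ→ℚ-cancelˡ p (begin
    pℚ ⊗ (a ⊖ b)           ≡⟨ solve 3 (λ a b c → c :* (a :- b) := c :* a :- c :* b) refl a b pℚ ⟩
    pℚ ⊗ a ⊖ pℚ ⊗ b         ≡⟨ e ⟩
    pℚ ⊗ powℚ pℚ ℓ ⊗ x      ≡⟨ ℚₚ.*-assoc pℚ (powℚ pℚ ℓ) x ⟩
    pℚ ⊗ (powℚ pℚ ℓ ⊗ x)    ∎))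

  ≈-multiple : ∀ {a ℓ} → Integral a → powℚ pℚ ℓ ⊗ a ≈[ ℓ ] 0ℚ
  ≈-multiple {a} {ℓ} h = congruent a h (ℚₚ.+-identityʳ (powℚ pℚ ℓ ⊗ a))

  mod⇒≈ : ∀ {a b ℓ} → a ≡ b mod[ p ^ ℓ ] → a ≈[ ℓ ] b
  mod⇒≈ {ℓ = ℓ} (c , h , e) = congruent c (pIntegral⇒Integral h) (trans e (cong (_⊗ c) (ℕ→ℚ-^ p ℓ)))

  ≈⇒mod : ∀ {a b ℓ} → a ≈[ ℓ ] b → a ≡ b mod[ p ^ ℓ ]
  ≈⇒mod {ℓ = ℓ} (congruent c h e) = c , Integral⇒pIntegral h , trans e (cong (_⊗ c) (sym (ℕ→ℚ-^ p ℓ)))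

  -- Evaluation of power series at t = p, truncated below degree L

  ev : ℕ → (ℕ → ℚ) → ℚ
  ev L f = ∑ L (λ m → powℚ pℚ m ⊗ f m)

  ev-cong : ∀ L {f g : ℕ → ℚ} → (∀ m → m < L → f m ≡ g m) → ev L f ≡ ev L g
  ev-cong L e = ∑-cong L (λ m m<L → cong (powℚ pℚ m ⊗_) (e m m<L))

  ev-+ : ∀ L f g → ev L (λ m → f m ⊕ g m) ≡ ev L f ⊕ ev L g
  ev-+ L f g = trans (∑-cong L (λ m _ → ℚₚ.*-distribˡ-+ (powℚ pℚ m) (f m) (g m))) (∑-+ L _ _)

  ev-∑ : ∀ L n (c : ℕ → ℚ) (f : ℕ → ℕ → ℚ) → ev L (λ m → ∑ n (λ j → c j ⊗ f j m)) ≡ ∑ n (λ j → c j ⊗ ev L (f j))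
  ev-∑ L n c f = begin
    ∑ L (λ m → powℚ pℚ m ⊗ ∑ n (λ j → c j ⊗ f j m))
      ≡⟨ ∑-cong L (λ m _ → sym (∑-*ˡ n (powℚ pℚ m) (λ j → c j ⊗ f j m))) ⟩
    ∑ L (λ m → ∑ n (λ j → powℚ pℚ m ⊗ (c j ⊗ f j m))) ≡⟨ ∑-swap L n (λ m j → powℚ pℚ m ⊗ (c j ⊗ f j m)) ⟩
    ∑ n (λ j → ∑ L (λ m → powℚ pℚ m ⊗ (c j ⊗ f j m)))
      ≡⟨ ∑-cong n (λ j _ → trans (∑-cong L (λ m _ → solve 3 (λ a b c → a :* (b :* c) := b :* (a :* c)) refl (powℚ pℚ m) (c j) (f j m)))
           (∑-*ˡ L (c j) (λ m → powℚ pℚ m ⊗ f j m))) ⟩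
    ∑ n (λ j → c j ⊗ ev L (f j)) ∎

  -- Shifting pushes the top coefficient out of the range. The two sides differ by p^L times that
  -- coefficient, which is p-integral.
  ev-shift-suc : ∀ L s {f : ℕ → ℚ} → (∀ m → m < L → Integral (f m)) → ev L (shift (suc s) f) ≈[ L ] pℚ ⊗ ev L (shift s f)
  ev-shift-suc zero    s h = ≡⇒≈ (sym (ℚₚ.*-zeroʳ pℚ))
  ev-shift-suc (suc L) s {f} h = ≈-sym (≈-trans (≡⇒≈ split) (≈-trans
    (≈-+ (≡⇒≈ {pℚ ⊗ ev L g} refl) (≈-multiple {ℓ = suc L} (I-shift s L (λ m m≤L → h m (s≤s m≤L))))) (≡⇒≈ join)))
    where
    g = shift s f
    split : pℚ ⊗ ev (suc L) g ≡ pℚ ⊗ ev L g ⊕ pℚ ⊗ powℚ pℚ L ⊗ g L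
    split = trans (cong (pℚ ⊗_) (∑-last L (λ m → powℚ pℚ m ⊗ g m)))
      (solve 4 (λ a b c d → a :* (b :+ c :* d) := a :* b :+ a :* c :* d) refl pℚ (ev L g) (powℚ pℚ L) (g L))
    join : pℚ ⊗ ev L g ⊕ 0ℚ ≡ ev (suc L) (shift (suc s) f)
    join = begin
      pℚ ⊗ ev L g ⊕ 0ℚ                            ≡⟨ ℚₚ.+-comm (pℚ ⊗ ev L g) 0ℚ ⟩
      0ℚ ⊕ pℚ ⊗ ev L g                            ≡⟨ cong (0ℚ ⊕_) (∑-*ˡ L pℚ (λ m → powℚ pℚ m ⊗ g m)) ⟨
      0ℚ ⊕ ∑ L (λ m → pℚ ⊗ (powℚ pℚ m ⊗ g m))      ≡⟨ cong (0ℚ ⊕_) (∑-cong L (λ m _ → ℚₚ.*-assoc pℚ (powℚ pℚ m) (g m))) ⟨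
      0ℚ ⊕ ∑ L (λ m → pℚ ⊗ powℚ pℚ m ⊗ g m)        ∎

  ev-shift : ∀ L s {f : ℕ → ℚ} → (∀ m → m < L → Integral (f m)) → ev L (shift s f) ≈[ L ] powℚ pℚ s ⊗ ev L f
  ev-shift L zero    h = ≡⇒≈ (sym (ℚₚ.*-identityˡ _))
  ev-shift L (suc s) {f} h = ≈-trans (ev-shift-suc L s h)
    (≈-trans (≈-*ˡ (I-ℕ p) (ev-shift L s h)) (≡⇒≈ (sym (ℚₚ.*-assoc pℚ (powℚ pℚ s) (ev L f)))))

  ev-≤ : ∀ {L L′} f → L ≤ L′ → (∀ m → m < L′ → Integral (f m)) → ev L′ f ≈[ L ] ev L f
  ev-≤ {L} f L≤L′ = go (ℕₚ.≤⇒≤′ L≤L′)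
    where
    go : ∀ {L′} → L ℕ.≤′ L′ → (∀ m → m < L′ → Integral (f m)) → ev L′ f ≈[ L ] ev L f
    go (ℕ.≤′-reflexive refl) h = ≡⇒≈ refl
    go (ℕ.≤′-step {L′} L≤′) h = ≈-trans (≡⇒≈ (∑-last L′ (λ m → powℚ pℚ m ⊗ f m)))
      (≈-trans (≈-+ (go L≤′ (λ m m< → h m (ℕₚ.m≤n⇒m≤1+n m<)))
                    (≈-weaken (ℕₚ.≤′⇒≤ L≤′) (≈-multiple {ℓ = L′} (h L′ ℕₚ.≤-refl))))
               (≡⇒≈ (ℚₚ.+-identityʳ (ev L f))))

  -- The value at t = p of the series whose divided powers `G` expands, with the same recursion on i
  -- and M as `G`.
  segment : (ℕ → ℚ) → ℕ → ℕ → ℚ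
  segment u i zero    = 0ℚ
  segment u i (suc M) = powℚ pℚ i ⊗ u i ⊕ segment u (suc i) M

  -- Induction on M: the recursion of `G` is the binomial theorem `divPow-+` with the first part p^i
  -- u_i split off, and each shift by i * j supplies the power (p^i)^j.
  ev-G : ∀ L u i M ν → ν < p → (∀ l → i ≤ l → l < i + M → Integral (u l)) → ev L (G u i M ν) ≈[ L ] divPow (segment u i M) ν
  -- Modulo p⁰ every p-integral difference is allowed, so the difference itself is the quotient.
  ev-G zero    u i zero ν       ν<p h = ≈-sym (congruent (divPow 0ℚ ν) (I-divPow ν ν<p (I-ℕ 0)) (trans (ℚₚ.+-identityʳ (divPow 0ℚ ν)) (sym (ℚₚ.*-identityˡ (divPow 0ℚ ν)))))
  ev-G (suc L) u i zero zero    ν<p h = ≡⇒≈ (trans (cong (1ℚ ⊗ 1ℚ ⊕_) (∑-zero L (λ m _ → ℚₚ.*-zeroʳ (powℚ pℚ (suc m))))) refl)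
  ev-G (suc L) u i zero (suc ν) ν<p h = ≡⇒≈ (trans (∑-zero (suc L) (λ m _ → ℚₚ.*-zeroʳ (powℚ pℚ m)))
    (sym (trans (cong (_⊗ invFact (suc ν)) (ℚₚ.*-zeroˡ (powℚ 0ℚ ν))) (ℚₚ.*-zeroˡ (invFact (suc ν))))))
  ev-G L u i (suc M) ν ν<p h = ≈-trans (≡⇒≈ (ev-∑ L (suc ν) (divPow (u i)) (λ j → shift (i * j) (g j))))
    (≈-trans (≈-∑ (suc ν) (λ { j (s≤s j≤ν) → term j j≤ν })) (≡⇒≈ (sym (divPow-+ (powℚ pℚ i ⊗ u i) (segment u (suc i) M) ν))))
    where
    g : ℕ → ℕ → ℚ
    g j = G u (suc i) M (ν ∸ j)
    h′ : ∀ l → suc i ≤ l → l < suc i + M → Integral (u l)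
    h′ l i<l l< = h l (ℕₚ.<⇒≤ i<l) (subst (l <_) (sym (ℕₚ.+-suc i M)) l<)
    lt : ∀ j → ν ∸ j < p
    lt j = ℕₚ.≤-<-trans (ℕₚ.m∸n≤m ν j) ν<p
    term : ∀ j → j ≤ ν → divPow (u i) j ⊗ ev L (shift (i * j) (g j)) ≈[ L ] divPow (powℚ pℚ i ⊗ u i) j ⊗ divPow (segment u (suc i) M) (ν ∸ j)
    term j j≤ν = ≈-trans (≈-*ˡ (I-divPow j (ℕₚ.≤-<-trans j≤ν ν<p) (h i ℕₚ.≤-refl (ℕₚ.m<m+n i (s≤s z≤n))))
        (≈-trans (ev-shift L (i * j) (λ m _ → I-G u (suc i) M (ν ∸ j) (lt j) h′ m))
                 (≈-*ˡ (I-pow (i * j) (I-ℕ p)) (ev-G L u (suc i) M (ν ∸ j) (lt j) h′))))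
      (≡⇒≈ (begin
        divPow (u i) j ⊗ (powℚ pℚ (i * j) ⊗ D)   ≡⟨ solve 3 (λ a b c → a :* (b :* c) := b :* a :* c) refl (divPow (u i) j) (powℚ pℚ (i * j)) D ⟩
        powℚ pℚ (i * j) ⊗ divPow (u i) j ⊗ D     ≡⟨ cong (λ z → z ⊗ divPow (u i) j ⊗ D) (powℚ-powℚ pℚ i j) ⟨
        powℚ (powℚ pℚ i) j ⊗ divPow (u i) j ⊗ D  ≡⟨ cong (_⊗ D) (divPow-* (powℚ pℚ i) (u i) j) ⟨
        divPow (powℚ pℚ i ⊗ u i) j ⊗ D           ∎))
      where D = divPow (segment u (suc i) M) (ν ∸ j)

  -- Fermat's little theorem and integrality of Fermat quotients

  powℚ-1 : ∀ k → powℚ 1ℚ k ≡ 1ℚ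
  powℚ-1 zero    = refl
  powℚ-1 (suc k) = trans (ℚₚ.*-identityˡ _) (powℚ-1 k)

  -- The middle terms of p! · divPow (a + 1) p carry the factor p! = p · (p - 1)! against denominators j! (p - j)! prime to p.
  frobenius : ∀ {a} q → p ≡ suc q → Integral a → powℚ (a ⊕ 1ℚ) (suc q) ≈[ 1 ] powℚ a (suc q) ⊕ 1ℚ
  frobenius {a} q p≡ h = congruent (ℕ→ℚ (q ℕ.!) ⊗ mid) (I-* (I-ℕ (q ℕ.!)) mid-int) (begin
    powℚ (a ⊕ 1ℚ) (suc q) ⊖ (powℚ a (suc q) ⊕ 1ℚ)
      ≡⟨ cong (_⊖ (powℚ a (suc q) ⊕ 1ℚ)) (trans (sym (divPow-! (a ⊕ 1ℚ) (suc q))) (cong (F ⊗_) expand)) ⟩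
    F ⊗ (divPow 1ℚ (suc q) ⊕ (mid ⊕ divPow a (suc q))) ⊖ (powℚ a (suc q) ⊕ 1ℚ)
      ≡⟨ solve 6 (λ f x m y u v → f :* (x :+ (m :+ y)) :- (u :+ v) := f :* m :+ (f :* x :- v) :+ (f :* y :- u)) refl
           F (divPow 1ℚ (suc q)) mid (divPow a (suc q)) (powℚ a (suc q)) 1ℚ ⟩
    F ⊗ mid ⊕ (F ⊗ divPow 1ℚ (suc q) ⊖ 1ℚ) ⊕ (F ⊗ divPow a (suc q) ⊖ powℚ a (suc q))
      ≡⟨ cong₂ (λ x y → F ⊗ mid ⊕ x ⊕ y) (cancel (trans (divPow-! 1ℚ (suc q)) (powℚ-1 (suc q)))) (cancel (divPow-! a (suc q))) ⟩
    F ⊗ mid ⊕ 0ℚ ⊕ 0ℚ        ≡⟨ trans (ℚₚ.+-identityʳ _) (ℚₚ.+-identityʳ _) ⟩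
    F ⊗ mid                  ≡⟨ cong (_⊗ mid) (ℕ→ℚ-* (suc q) (q ℕ.!)) ⟩
    ℕ→ℚ (suc q) ⊗ ℕ→ℚ (q ℕ.!) ⊗ mid ≡⟨ cong (λ z → ℕ→ℚ z ⊗ ℕ→ℚ (q ℕ.!) ⊗ mid) p≡ ⟨
    pℚ ⊗ ℕ→ℚ (q ℕ.!) ⊗ mid    ≡⟨ ℚₚ.*-assoc pℚ (ℕ→ℚ (q ℕ.!)) mid ⟩
    pℚ ⊗ (ℕ→ℚ (q ℕ.!) ⊗ mid)  ≡⟨ cong (_⊗ (ℕ→ℚ (q ℕ.!) ⊗ mid)) (ℚₚ.*-identityʳ pℚ) ⟨
    powℚ pℚ 1 ⊗ (ℕ→ℚ (q ℕ.!) ⊗ mid) ∎)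
    where
    F = ℕ→ℚ (suc q ℕ.!)
    t : ℕ → ℚ
    t j = divPow a j ⊗ divPow 1ℚ (suc q ∸ j)
    mid = ∑ q (λ j → t (suc j))
    cancel : ∀ {x y} → x ≡ y → x ⊖ y ≡ 0ℚ
    cancel {x} refl = ℚₚ.+-inverseʳ x
    mid-int : Integral mid
    mid-int = I-∑ q λ j j<q →
      I-* (I-divPow (suc j) (subst (suc j <_) (sym p≡) (s≤s j<q)) h)
          (I-divPow (q ∸ j) (subst (q ∸ j <_) (sym p≡) (s≤s (ℕₚ.m∸n≤m q j))) (I-ℕ 1))
    expand : divPow (a ⊕ 1ℚ) (suc q) ≡ divPow 1ℚ (suc q) ⊕ (mid ⊕ divPow a (suc q))
    expand = trans (divPow-+ a 1ℚ (suc q)) (cong₂ _⊕_ (ℚₚ.*-identityˡ (divPow 1ℚ (suc q)))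
      (trans (∑-last q (λ j → t (suc j))) (cong (mid ⊕_)
        (trans (cong (λ z → divPow a (suc q) ⊗ divPow 1ℚ z) (ℕₚ.n∸n≡0 q)) (ℚₚ.*-identityʳ (divPow a (suc q)))))))

  fermat : ∀ q → p ≡ suc q → ∀ a → powℚ (ℕ→ℚ a) (suc q) ≈[ 1 ] ℕ→ℚ a
  fermat q p≡ zero    = ≡⇒≈ (ℚₚ.*-zeroˡ (powℚ 0ℚ q))
  fermat q p≡ (suc a) = subst (λ z → powℚ z (suc q) ≈[ 1 ] z) (trans (sym (ℕ→ℚ-+ a 1)) (cong ℕ→ℚ (ℕₚ.+-comm a 1)))
    (≈-trans (frobenius q p≡ (I-ℕ a)) (≈-+ (fermat q p≡ a) (≡⇒≈ refl)))

  -- With a^p - a = p c, the product of a and the quotient is c; then a is cancelled because it is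
  -- prime to p.
  fermatQuotient-integral : ∀ a .{{_ : NonZero a}} → a < p → Integral (fermatQuotient p a)
  fermatQuotient-integral a a<p with fermat (p ∸ 1) (sym suc[p∸1]≡p) a
  ... | congruent c c-int e = I-cancel a (p∤-< a<p) (subst Integral (sym (ℕ→ℚ-cancelˡ p (begin
    pℚ ⊗ (A ⊗ fq)             ≡⟨ solve 3 (λ x y z → x :* (y :* z) := y :* (z :* x)) refl pℚ A fq ⟩
    A ⊗ (fq ⊗ pℚ)             ≡⟨ cong (A ⊗_) (/-*-cancel (+ (a ℕ.^ r) ℤ.- + 1) p) ⟩
    A ⊗ ℤ→ℚ (+ (a ℕ.^ r) ℤ.- + 1) ≡⟨ cong (A ⊗_) (trans (ℤ→ℚ-+ (+ (a ℕ.^ r)) (ℤ.- + 1)) (cong (_⊖ 1ℚ) (ℕ→ℚ-^ a r))) ⟩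
    A ⊗ (powℚ A r ⊖ 1ℚ)      ≡⟨ solve 3 (λ x y o → x :* (y :- o) := x :* y :- x :* o) refl A (powℚ A r) 1ℚ ⟩
    A ⊗ powℚ A r ⊖ A ⊗ 1ℚ    ≡⟨ cong (A ⊗ powℚ A r ⊖_) (ℚₚ.*-identityʳ A) ⟩
    A ⊗ powℚ A r ⊖ A         ≡⟨ e ⟩
    pℚ ⊗ 1ℚ ⊗ c               ≡⟨ cong (_⊗ c) (ℚₚ.*-identityʳ pℚ) ⟩
    pℚ ⊗ c                    ∎))) c-int)
    where
    A = ℕ→ℚ a
    fq = fermatQuotient p a
    r = p ∸ 1

  Qp-integral : ∀ m → Integral (Qp p m)
  Qp-integral m = subst Integral (sym (Σ[⋯]-∑ 1 (p ∸ 1) _)) (I-∑ (p ∸ 1) λ a a< →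
    I-pow m (fermatQuotient-integral (suc a) (subst (suc a <_) suc[p∸1]≡p (s≤s a<))))

  -- Integrality of ψ_ν/ν!

  module _ (x : ℕ → ℚ) (x-int : ∀ i → Integral (x i)) where

    u : ℕ → ℚ
    u = scaled (psi x)

    I-sgn : ∀ k → Integral (sgn k)
    I-sgn k = I-pow k (I-neg (I-ℕ 1))

    I-sigmaHat : ∀ k → k < p → Integral (sigmaHat x k)
    I-sigmaHat k k<p = I-* (I-* (I-sgn k) (subst Integral (sym (Σ[⋯]-∑ 1 k (λ j → bellPartial k j y))) (I-∑ k bell))) (I-invFact k k<p)
      where
      y : ℕ → ℚ
      y i = ⊝ (ℕ→ℚ ((i ∸ 1) ℕ.!) ⊗ x i)
      bell : ∀ j → j < k → Integral (bellPartial k (suc j) y)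
      bell j j<k = subst Integral (sym (bellPartial-G k (suc j) y j<k)) (I-* (I-ℕ (k ℕ.!))
        (I-G (scaled y) 1 (k ∸ suc j + 1) (suc j) (ℕₚ.≤-<-trans j<k k<p) (λ l _ l< →
          I-* (I-neg (I-* (I-ℕ ((l ∸ 1) ℕ.!)) (x-int l)))
              (I-invFact l (ℕₚ.≤-<-trans (ℕₚ.≤-trans (ℕ.s≤s⁻¹ l<) len≤k) k<p))) k))
        where
        len≤k : k ∸ suc j + 1 ≤ k
        len≤k = ℕₚ.≤-trans (ℕₚ.+-monoʳ-≤ (k ∸ suc j) (s≤s (z≤n {j}))) (ℕₚ.≤-reflexive (ℕₚ.m∸n+n≡m j<k))

    -- The recurrence with M = N builds u_{N+1} from u_1, ..., u_N by ring operations, integers and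
    -- inverse factorials of numbers up to N + 1 < p.
    I-u-≤ : ∀ N → N < p → ∀ i → i ≤ N → Integral (u i)
    I-u-≤ zero    _   zero _ = I-ℕ 0
    I-u-≤ (suc N) N<p i i≤ with ℕₚ.m≤n⇒m<n∨m≡n i≤
    ... | inj₁ (s≤s i≤N) = I-u-≤ N (ℕₚ.<⇒≤ N<p) i i≤N
    ... | inj₂ refl = subst Integral (sym (scaled-psi-suc x N N N ℕₚ.≤-refl ℕₚ.≤-refl))
      (I-+ (I-+ (ih N ℕₚ.≤-refl) (I-sigmaHat (suc N) N<p)) (I-∑ N λ i i<N → I-* (I-sgn (3 + i)) (I-∑ (3 + i) λ k _ →
        I-* (I-ℤ (stirling1 (3 + i) (suc k))) (I-shift k (suc N) λ m _ →
          I-G u 1 N (2 + i) (ℕₚ.≤-<-trans (s≤s i<N) N<p) (λ l _ l< → ih l (ℕ.s≤s⁻¹ l<)) m))))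
      where
      ih : ∀ i → i ≤ N → Integral (u i)
      ih = I-u-≤ N (ℕₚ.<⇒≤ N<p)

    I-u : ∀ i → i < p → Integral (u i)
    I-u i i<p = I-u-≤ i i<p i ℕₚ.≤-refl

    -- The congruence satisfied by W and the comparison with w

    module _ (n : ℕ) (n<p : n < p) where

      -- The length is n for every modulus, so a single number is compared with all w_ℓ; the cut to
      -- ℓ terms is made only at the end.
      W : ℚ
      W = ev n (u ∘ suc)

      -- Used at i = 0, where it says that the full segment is p W; the offset is needed because the
      -- recursion moves the starting index.
      segment-factor : ∀ i M → segment u (suc i) M ≡ pℚ ⊗ ∑ M (λ l → powℚ pℚ (i + l) ⊗ u (suc (i + l)))
      segment-factor i zero    = sym (ℚₚ.*-zeroʳ pℚ)
      segment-factor i (suc M) = trans (cong₂ _⊕_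
          (trans (ℚₚ.*-assoc pℚ (powℚ pℚ i) (u (suc i))) (cong (λ z → pℚ ⊗ (powℚ pℚ z ⊗ u (suc z))) (sym (ℕₚ.+-identityʳ i))))
          (trans (segment-factor (suc i) M) (cong (pℚ ⊗_) (∑-cong M (λ l _ → cong (λ z → powℚ pℚ z ⊗ u (suc z)) (sym (ℕₚ.+-suc i l)))))))
        (sym (ℚₚ.*-distribˡ-+ pℚ _ _))

      I-W : Integral W
      I-W = I-∑ n λ i i<n → I-* (I-pow i (I-ℕ p)) (I-u (suc i) (ℕₚ.≤-<-trans i<n n<p))

      ev-H : ∀ L ν → ν ≤ n → ev L (H u n ν) ≈[ L ] ℕ→ℚ ((p ∸ 1) C ν) ⊗ powℚ (pℚ ⊗ W) ν
      ev-H L ν ν≤n = ≈-trans (≡⇒≈ (ev-∑ L (suc ν) (s₁ ν) (λ k → shift k (G u 1 n ν))))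
        (≈-trans (≈-∑ (suc ν) (λ k _ → ≈-*ˡ (I-ℤ (stirling1 (suc ν) (suc k)))
          (≈-trans (ev-shift L k (λ m _ → I-G u 1 n ν ν<p int m)) (≈-*ˡ (I-pow k (I-ℕ p)) (ev-G L u 1 n ν ν<p int)))))
        (≡⇒≈ collect))
        where
        ν<p : ν < p
        ν<p = ℕₚ.≤-<-trans ν≤n n<p
        ν≤p∸1 : ν ≤ p ∸ 1
        ν≤p∸1 = ℕ.s≤s⁻¹ (subst (ν <_) (sym suc[p∸1]≡p) ν<p)
        int : ∀ l → 1 ≤ l → l < 1 + n → Integral (u l)
        int l _ l< = I-u l (ℕₚ.≤-<-trans (ℕ.s≤s⁻¹ l<) n<p)
        D : ℚ
        D = divPow (segment u 1 n) ν
        collect : ∑ (suc ν) (λ k → s₁ ν k ⊗ (powℚ pℚ k ⊗ D)) ≡ ℕ→ℚ ((p ∸ 1) C ν) ⊗ powℚ (pℚ ⊗ W) ν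
        collect = begin
          ∑ (suc ν) (λ k → s₁ ν k ⊗ (powℚ pℚ k ⊗ D)) ≡⟨ ∑-cong (suc ν) (λ k _ → sym (ℚₚ.*-assoc (s₁ ν k) (powℚ pℚ k) D)) ⟩
          ∑ (suc ν) (λ k → s₁ ν k ⊗ powℚ pℚ k ⊗ D)   ≡⟨ ∑-*ʳ (suc ν) D (λ k → s₁ ν k ⊗ powℚ pℚ k) ⟩
          ∑ (suc ν) (λ k → s₁ ν k ⊗ powℚ pℚ k) ⊗ D
            ≡⟨ cong (_⊗ D) (subst (λ z → ∑ (suc ν) (λ k → s₁ ν k ⊗ powℚ (ℕ→ℚ z) k) ≡ ℕ→ℚ ((p ∸ 1) P′ ν)) suc[p∸1]≡p (stirling1-falling (p ∸ 1) ν ν≤p∸1)) ⟩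
          ℕ→ℚ ((p ∸ 1) P′ ν) ⊗ D                    ≡⟨ cong (_⊗ D) (trans (cong ℕ→ℚ (sym (nCk*k!≡nP′k ν≤p∸1))) (ℕ→ℚ-* ((p ∸ 1) C ν) (ν ℕ.!))) ⟩
          ℕ→ℚ ((p ∸ 1) C ν) ⊗ ℕ→ℚ (ν ℕ.!) ⊗ D       ≡⟨ ℚₚ.*-assoc (ℕ→ℚ ((p ∸ 1) C ν)) (ℕ→ℚ (ν ℕ.!)) D ⟩
          ℕ→ℚ ((p ∸ 1) C ν) ⊗ (ℕ→ℚ (ν ℕ.!) ⊗ D)     ≡⟨ cong (ℕ→ℚ ((p ∸ 1) C ν) ⊗_) (trans (divPow-! (segment u 1 n) ν) (cong (λ z → powℚ z ν) (segment-factor 0 n))) ⟩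
          ℕ→ℚ ((p ∸ 1) C ν) ⊗ powℚ (pℚ ⊗ W) ν        ∎

      correction : ℕ → ℚ → ℚ
      correction i a = sigmaHat x (2 + i) ⊕ ℕ→ℚ ((p ∸ 1) C (2 + i)) ⊗ sgn (1 + i) ⊗ powℚ a (2 + i)

      -- Here ℓ = q + 1 and ν = i + 1, so w_{ℓ-ν} is `v (q ∸ i)`. Keeping the sequence v as an
      -- argument lets w and the constant sequence W be compared.
      rhs : ℕ → (ℕ → ℚ) → ℚ
      rhs q v = x 1 ⊕ pℚ ⊗ v q ⊕ ∑ q (λ i → powℚ pℚ (1 + i) ⊗ correction i (v (q ∸ i)))

      W-fixed : ∀ q → suc q ≤ n → W ≈[ suc q ] rhs q (λ _ → W)
      W-fixed q q<n = ≈-cancel (≈-trans (≈-sym evu≈) (≈-trans (≡⇒≈ split)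
          (≈-trans (≈-+ (≈-+ shifted (≡⇒≈ sigma)) corrections) (≡⇒≈ assemble))))
        where
        L : ℕ
        L = suc (suc q)
        int : ∀ m → m < L → Integral (u m)
        int m m<L = I-u m (ℕₚ.≤-<-trans (ℕₚ.≤-trans (ℕ.s≤s⁻¹ m<L) q<n) n<p)
        -- Cutting W after q + 1 terms is harmless modulo p^(q+1), and the factor p gains the
        -- remaining power.
        evu≈ : ev L u ≈[ L ] pℚ ⊗ W
        evu≈ = ≈-trans (≡⇒≈ factored) (subst (λ z → z ⊗ ev (suc q) (u ∘ suc) ≈[ L ] z ⊗ W) (ℚₚ.*-identityʳ pℚ)
          (≈-raise 1 (≈-sym (ev-≤ (u ∘ suc) q<n (λ m m<n → I-u (suc m) (ℕₚ.≤-<-trans m<n n<p))))))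
          where
          factored : ev L u ≡ pℚ ⊗ ev (suc q) (u ∘ suc)
          factored = trans (ℚₚ.+-identityˡ _) (trans (∑-cong (suc q) (λ l _ → ℚₚ.*-assoc pℚ (powℚ pℚ l) (u (suc l))))
            (∑-*ˡ (suc q) pℚ (λ l → powℚ pℚ l ⊗ u (suc l))))
        c : ℕ → ℕ → ℚ
        c i = H u n (2 + i)
        σ : ℕ → ℚ
        σ = sigmaHat x
        recurrence : ∀ m → m < L → u m ≡ shift 1 u m ⊕ σ m ⊕ ∑ q (λ i → sgn (3 + i) ⊗ c i m)
        -- In degree 0 all terms vanish; in particular `sigmaHat x 0` is 0, because B_0 is an empty
        -- sum here and not 1.
        recurrence zero _ = sym (trans (ℚₚ.+-identityˡ _) (∑-zero q λ i _ →
          trans (cong (sgn (3 + i) ⊗_) (H-small u n (2 + i) 0 (s≤s z≤n))) (ℚₚ.*-zeroʳ (sgn (3 + i)))))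
        recurrence (suc N) (s≤s N<L) = scaled-psi-suc x n q N (ℕₚ.≤-trans (ℕ.s≤s⁻¹ N<L) (ℕₚ.<⇒≤ q<n)) (ℕ.s≤s⁻¹ N<L)
        split : ev L u ≡ ev L (shift 1 u) ⊕ ev L σ ⊕ ∑ q (λ i → sgn (3 + i) ⊗ ev L (c i))
        split = trans (ev-cong L recurrence) (trans (ev-+ L (λ m → shift 1 u m ⊕ σ m) (λ m → ∑ q (λ i → sgn (3 + i) ⊗ c i m)))
          (cong₂ _⊕_ (ev-+ L (shift 1 u) σ) (ev-∑ L q (λ i → sgn (3 + i)) c)))
        shifted : ev L (shift 1 u) ≈[ L ] pℚ ⊗ (pℚ ⊗ W)
        shifted = ≈-trans (ev-shift-suc L 0 int) (≈-*ˡ (I-ℕ p) evu≈)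
        sigma : ev L σ ≡ pℚ ⊗ (x 1 ⊕ ∑ q (λ i → powℚ pℚ (1 + i) ⊗ σ (2 + i)))
        sigma = begin
          1ℚ ⊗ σ 0 ⊕ (pℚ ⊗ 1ℚ ⊗ σ 1 ⊕ ∑ q (λ i → pℚ ⊗ powℚ pℚ (1 + i) ⊗ σ (2 + i))) ≡⟨ ℚₚ.+-identityˡ _ ⟩
          pℚ ⊗ 1ℚ ⊗ σ 1 ⊕ ∑ q (λ i → pℚ ⊗ powℚ pℚ (1 + i) ⊗ σ (2 + i))
            ≡⟨ cong₂ _⊕_ (cong₂ _⊗_ (ℚₚ.*-identityʳ pℚ) (sigmaHat-1 x))
                 (trans (∑-cong q (λ i _ → ℚₚ.*-assoc pℚ (powℚ pℚ (1 + i)) (σ (2 + i)))) (∑-*ˡ q pℚ (λ i → powℚ pℚ (1 + i) ⊗ σ (2 + i)))) ⟩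
          pℚ ⊗ x 1 ⊕ pℚ ⊗ ∑ q (λ i → powℚ pℚ (1 + i) ⊗ σ (2 + i)) ≡⟨ ℚₚ.*-distribˡ-+ pℚ (x 1) _ ⟨
          pℚ ⊗ (x 1 ⊕ ∑ q (λ i → powℚ pℚ (1 + i) ⊗ σ (2 + i))) ∎
        b : ℕ → ℚ
        b i = ℕ→ℚ ((p ∸ 1) C (2 + i)) ⊗ sgn (1 + i) ⊗ powℚ W (2 + i)
        corrections : ∑ q (λ i → sgn (3 + i) ⊗ ev L (c i)) ≈[ L ] pℚ ⊗ ∑ q (λ i → powℚ pℚ (1 + i) ⊗ b i)
        corrections = ≈-trans (≈-∑ q (λ i i<q → ≈-trans
            (≈-*ˡ (I-sgn (3 + i)) (ev-H L (2 + i) (ℕₚ.≤-trans (s≤s i<q) q<n))) (≡⇒≈ (rearrange i))))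
          (≡⇒≈ (∑-*ˡ q pℚ (λ i → powℚ pℚ (1 + i) ⊗ b i)))
          where
          -- The recurrence calls this summand ν = i + 2 with sign (-1)^(ν+1), the congruence calls
          -- it ν = i + 1 with sign (-1)^ν; the signs agree. One factor p of (p W)^(i+2) is set
          -- aside for the cancellation.
          rearrange : ∀ i → sgn (3 + i) ⊗ (ℕ→ℚ ((p ∸ 1) C (2 + i)) ⊗ powℚ (pℚ ⊗ W) (2 + i)) ≡ pℚ ⊗ (powℚ pℚ (1 + i) ⊗ b i)
          rearrange i = begin
            sgn (3 + i) ⊗ (B ⊗ powℚ (pℚ ⊗ W) (2 + i)) ≡⟨ cong₂ (λ s w → s ⊗ (B ⊗ w)) (sgn-+2 (1 + i)) (powℚ-distrib-* pℚ W (2 + i)) ⟩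
            sgn (1 + i) ⊗ (B ⊗ (pℚ ⊗ powℚ pℚ (1 + i) ⊗ powℚ W (2 + i)))
              ≡⟨ solve 5 (λ s b p q w → s :* (b :* (p :* q :* w)) := p :* (q :* (b :* s :* w))) refl
                   (sgn (1 + i)) B pℚ (powℚ pℚ (1 + i)) (powℚ W (2 + i)) ⟩
            pℚ ⊗ (powℚ pℚ (1 + i) ⊗ b i) ∎
            where B = ℕ→ℚ ((p ∸ 1) C (2 + i))
        assemble : pℚ ⊗ (pℚ ⊗ W) ⊕ pℚ ⊗ (x 1 ⊕ ∑ q (λ i → powℚ pℚ (1 + i) ⊗ σ (2 + i))) ⊕ pℚ ⊗ ∑ q (λ i → powℚ pℚ (1 + i) ⊗ b i)
          ≡ pℚ ⊗ rhs q (λ _ → W)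
        assemble = trans (solve 5 (λ p w x s t → p :* w :+ p :* (x :+ s) :+ p :* t := p :* (x :+ w :+ (s :+ t))) refl
            pℚ (pℚ ⊗ W) (x 1) (∑ q (λ i → powℚ pℚ (1 + i) ⊗ σ (2 + i))) (∑ q (λ i → powℚ pℚ (1 + i) ⊗ b i)))
          (cong (λ z → pℚ ⊗ (x 1 ⊕ pℚ ⊗ W ⊕ z)) (trans (sym (∑-+ q _ _))
            (∑-cong q (λ i _ → sym (ℚₚ.*-distribˡ-+ (powℚ pℚ (1 + i)) (σ (2 + i)) (b i))))))

      rhs-cong : ∀ q (v : ℕ → ℚ) → (∀ m → 1 ≤ m → m ≤ q → Integral (v m)) → (∀ m → 1 ≤ m → m ≤ q → v m ≈[ m ] W) → 1 ≤ q → suc q ≤ n →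
        rhs q v ≈[ suc q ] rhs q (λ _ → W)
      rhs-cong q v v-int v≈W 1≤q q<n = ≈-+ (≈-+ (≡⇒≈ {x 1} refl) linear) (≈-∑ q power)
        where
        linear : pℚ ⊗ v q ≈[ suc q ] pℚ ⊗ W
        linear = subst (λ z → z ⊗ v q ≈[ suc q ] z ⊗ W) (ℚₚ.*-identityʳ pℚ) (≈-raise 1 (v≈W q 1≤q ℕₚ.≤-refl))
        power : ∀ i → i < q → powℚ pℚ (1 + i) ⊗ correction i (v (q ∸ i)) ≈[ suc q ] powℚ pℚ (1 + i) ⊗ correction i W
        -- The exponents add up to (1 + i) + (q - i) = q + 1.
        power i i<q = subst (λ z → powℚ pℚ (1 + i) ⊗ correction i (v (q ∸ i)) ≈[ suc z ] powℚ pℚ (1 + i) ⊗ correction i W)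
          (ℕₚ.m+[n∸m]≡n (ℕₚ.<⇒≤ i<q))
          (≈-raise (1 + i) (≈-+ (≡⇒≈ {sigmaHat x (2 + i)} refl) (≈-*ˡ (I-* (I-ℕ ((p ∸ 1) C (2 + i))) (I-sgn (1 + i)))
            (≈-pow (2 + i) (v-int (q ∸ i) pos (ℕₚ.m∸n≤m q i)) I-W (v≈W (q ∸ i) pos (ℕₚ.m∸n≤m q i))))))
          where
          pos : 1 ≤ q ∸ i
          pos = ℕₚ.m<n⇒0<n∸m i<q

      module _ (w : ℕ → ℚ) (w-int : ∀ ℓ → 1 ≤ ℓ → ℓ ≤ n → Integral (w ℓ)) (w-1 : w 1 ≈[ 1 ] x 1)
               (w-step : ∀ q → 1 ≤ q → suc q ≤ n → w (suc q) ≈[ suc q ] rhs q w) where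

        w≈W-≤ : ∀ N ℓ → ℓ ≤ N → 1 ≤ ℓ → ℓ ≤ n → w ℓ ≈[ ℓ ] W
        -- For q = 0 the correction sum is empty and p W vanishes modulo p, so W ≡ x_1, which is the
        -- hypothesis on w_1.
        w≈W-≤ (suc N) (suc zero) _ _ 1≤n = ≈-trans w-1 (≈-sym (≈-trans (W-fixed 0 1≤n)
          (≈-trans (≈-+ (≈-+ (≡⇒≈ {x 1} refl) PW≈0) (≡⇒≈ {0ℚ} refl))
                   (≡⇒≈ (trans (ℚₚ.+-identityʳ (x 1 ⊕ 0ℚ)) (ℚₚ.+-identityʳ (x 1)))))))
          where
          PW≈0 : pℚ ⊗ W ≈[ 1 ] 0ℚ
          PW≈0 = subst (λ z → z ⊗ W ≈[ 1 ] 0ℚ) (ℚₚ.*-identityʳ pℚ) (≈-multiple {ℓ = 1} I-W)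
        w≈W-≤ (suc N) (suc q@(suc _)) (s≤s q≤N) _ q<n = ≈-trans (w-step q (s≤s z≤n) q<n)
          (≈-trans (rhs-cong q w (λ m 1≤m m≤q → w-int m 1≤m (ℕₚ.≤-trans m≤q (ℕₚ.<⇒≤ q<n)))
                     (λ m 1≤m m≤q → w≈W-≤ N m (ℕₚ.≤-trans m≤q q≤N) 1≤m (ℕₚ.≤-trans m≤q (ℕₚ.<⇒≤ q<n))) (s≤s z≤n) q<n)
                   (≈-sym (W-fixed q q<n)))

        w≈ev : ∀ ℓ → 1 ≤ ℓ → ℓ ≤ n → w ℓ ≈[ ℓ ] ev ℓ (u ∘ suc)
        w≈ev ℓ 1≤ℓ ℓ≤n = ≈-trans (w≈W-≤ ℓ ℓ ℕₚ.≤-refl 1≤ℓ ℓ≤n)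
          (ev-≤ (u ∘ suc) ℓ≤n (λ m m<n → I-u (suc m) (ℕₚ.≤-<-trans m<n n<p)))

theorem3p4 : (n p : ℕ) → .{{_ : NonZero p}} → 2 ≤ n → Prime p → ¬ (2 ∣ p) → n < p →
    (w : ℕ → ℚ) →
    (∀ ℓ → 1 ≤ ℓ → ℓ ≤ n → pIntegral p (w ℓ)) →
    w 1 ≡ Qp p 1 mod[ p ^ 1 ] →
    (∀ ℓ → 2 ≤ ℓ → ℓ ≤ n →
    w ℓ ≡ Qp p 1 Q.+ ℕ→ℚ p Q.* w (ℓ ∸ 1)
    Q.+ Σ[ 1 ⋯ ℓ ∸ 1 ] (λ ν → ℕ→ℚ (p ℕ.^ ν) Q.*
    (sigmaHat (Qp p) (ν + 1)
    Q.+ ℕ→ℚ ((p ∸ 1) C (ν + 1)) Q.* sgn ν Q.* powℚ (w (ℓ ∸ ν)) (ν + 1)))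
    mod[ p ^ ℓ ]) →
    ∀ ℓ → 1 ≤ ℓ → ℓ ≤ n →
    w ℓ ≡ Σ[ 1 ⋯ ℓ ] (λ ν → ℕ→ℚ (p ℕ.^ (ν ∸ 1)) Q.* invFact ν Q.* psi (Qp p) ν) mod[ p ^ ℓ ]
theorem3p4 n p _ pp _ n<p w w-int w-1 w-step ℓ 1≤ℓ ℓ≤n = ≈⇒mod (≈-trans
    (w≈ev x Qp-integral n n<p w (λ ℓ 1≤ ≤n → pIntegral⇒Integral (w-int ℓ 1≤ ≤n)) (mod⇒≈ w-1) step ℓ 1≤ℓ ℓ≤n)
    (≡⇒≈ (sym conclusion)))
  where
  open Localization pp
  x : ℕ → ℚ
  x = Qp p
  conclusion : Σ[ 1 ⋯ ℓ ] (λ ν → ℕ→ℚ (p ℕ.^ (ν ∸ 1)) ⊗ invFact ν ⊗ psi x ν) ≡ ev ℓ (scaled (psi x) ∘ suc)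
  conclusion = trans (Σ[⋯]-∑ 1 ℓ _) (∑-cong ℓ λ i _ → trans
    (cong (λ z → z ⊗ invFact (suc i) ⊗ psi x (suc i)) (ℕ→ℚ-^ p i))
    (solve 3 (λ a b c → a :* b :* c := a :* (c :* b)) refl (powℚ pℚ i) (invFact (suc i)) (psi x (suc i))))
  step : ∀ q → 1 ≤ q → suc q ≤ n → w (suc q) ≈[ suc q ] rhs x Qp-integral n n<p q w
  step q 1≤q q<n = ≈-trans (mod⇒≈ (w-step (suc q) (s≤s 1≤q) q<n)) (≡⇒≈ (cong (x 1 ⊕ pℚ ⊗ w q ⊕_)
    (trans (Σ[⋯]-∑ 1 q _) (∑-cong q λ i _ → cong₂ (λ a b → a ⊗ (sigmaHat x (suc b) ⊕
        ℕ→ℚ ((p ∸ 1) C suc b) ⊗ sgn (1 + i) ⊗ powℚ (w (q ∸ i)) (suc b)))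
      (ℕ→ℚ-^ p (suc i)) (ℕₚ.+-comm i 1)))))
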